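{- Let $0<p<1$ and let $X_1,\ldots,X_n$ be independent random variables, each following the same distribution as a random variable $X\sim b(p)$. Let $S_n=\sum_{i=1}^n X_i$. Then, for any $r$ such that $p<r<1$, writing $r=(1+\delta)p$ with $\delta>0$, $$P(S_n\ge rn)=P(S_n\ge(1+\delta)pn)\le\left(\frac{e^r\cdot p^r}{e^p\cdot r^r}\right)^n=\left(\frac{e^{\delta}}{(1+\delta)^{(1+\delta)}}\right)^{pn}.$$
   Context: $b(p)$ denotes the Bernoulli distribution with $P(X=1)=p$, $P(X=0)=1-p$. Here $n\ge 1$ is an integer. -}

module Defs where

open import Algebra.Bundles using (CommutativeRing; Semiring)
import Algebra.Definitions.RawSemiring as RawSemiringDefs
open import Data.Fin.Base using (Fin; toℕ)
open import Data.Nat.Base as ℕ using (ℕ; suc)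
open import Data.Product.Base using (∃; _×_)
open import Level using (0ℓ) renaming (suc to lsuc)
open import Relation.Binary.Core using (Rel)
open import Relation.Binary.PropositionalEquality.Core using (_≢_)
open import Relation.Binary.Structures using (IsStrictTotalOrder)
import Relation.Binary.Construct.StrictToNonStrict as NonStrict
open import Relation.Unary
  using (Pred; _∈_; _≐_; _⊥_; _⊢_; U; ∁; Satisfiable)

-- The real numbers, characterised up to isomorphism as the Dedekind-complete
-- ordered field.  The reading is the classical one: the order is trichotomous,
-- hence decidable, and every inhabited subset that is bounded above has a least
-- upper bound.
-- The operations _⁻¹ and sup are total, but nothing is assumed about 0# ⁻¹, nor
-- about sup A when A is empty or unbounded above.

record Reals : Set₁ where
  infix  8 _⁻¹
  infixl 7 _/_
  infix  4 _<_ _≥_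

  field
    commutativeRing : CommutativeRing 0ℓ 0ℓ

  open CommutativeRing commutativeRing public

  field
    _<_                : Rel Carrier 0ℓ
    isStrictTotalOrder : IsStrictTotalOrder _≈_ _<_
    +-monoʳ-<          : ∀ x {y z} → y < z → x + y < x + z
    *-pos              : ∀ {x y} → 0# < x → 0# < y → 0# < x * y
    0≉1                : 0# ≉ 1#
    _⁻¹                : Carrier → Carrier
    ⁻¹-inverseʳ        : ∀ x → x ≉ 0# → x * x ⁻¹ ≈ 1#

  open NonStrict _≈_ _<_ public using (_≤_)

  _≥_ : Rel Carrier 0ℓ
  x ≥ y = y ≤ x

  _/_ : Carrier → Carrier → Carrier
  x / y = x * y ⁻¹

  IsUpperBound : Pred Carrier 0ℓ → Pred Carrier 0ℓ
  IsUpperBound A b = ∀ x → x ∈ A → x ≤ b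

  IsLeastUpperBound : Pred Carrier 0ℓ → Pred Carrier 0ℓ
  IsLeastUpperBound A s = IsUpperBound A s × (∀ b → IsUpperBound A b → s ≤ b)

  field
    sup     : Pred Carrier 0ℓ → Carrier
    sup-lub : ∀ A → Satisfiable A → Satisfiable (IsUpperBound A) →
              IsLeastUpperBound A (sup A)

  open RawSemiringDefs (Semiring.rawSemiring semiring) public
    using (_^_; sum; product) renaming (_×_ to _·_)

  fromℕ : ℕ → Carrier
  fromℕ n = n · 1#

open Reals ⦃ ... ⦄ public
  using ( Carrier; _≈_; _<_; _≤_; _≥_; _+_; _*_; _-_; _/_; 0#; 1#
        ; _^_; sum; product; sup; fromℕ )

module _ ⦃ ℝ : Reals ⦄ where

  infix  4 _⟶_
  infixr 8 _^ᵣ_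

  _⟶_ : (ℕ → Carrier) → Carrier → Set
  u ⟶ l = ∀ (ε : Carrier) → 0# < ε → ∃ λ N → ∀ n → N ℕ.≤ n → l - ε < u n × u n < l + ε

  liminf : (ℕ → Carrier) → Carrier
  liminf u = sup λ y → ∃ λ N → ∀ n → N ℕ.≤ n → y ≤ u n

  -- exp x = lim (1 + x/n)ⁿ.  The sequence converges, so that its lower limit
  -- is its limit; the index is shifted to avoid n = 0.
  exp : Carrier → Carrier
  exp x = liminf λ n → (1# + x / fromℕ (suc n)) ^ suc n

  -- For 0# < x this is the inverse of the increasing function exp; other
  -- arguments give meaningless values.
  log : Carrier → Carrier
  log x = sup λ y → exp y ≤ x

  -- Only for x positive.
  _^ᵣ_ : Carrier → Carrier → Carrier
  x ^ᵣ y = exp (y * log x)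

  data Borel : Pred Carrier 0ℓ → Set₁ where
    half-line  : (a : Carrier) → Borel (_≤ a)
    complement : ∀ {B} → Borel B → Borel (∁ B)
    union      : ∀ {B : ℕ → Pred Carrier 0ℓ} →
                 (∀ i → Borel (B i)) → Borel (λ x → ∃ λ i → B i x)
    resp-≐     : ∀ {B C} → B ≐ C → Borel B → Borel C

  -- P is given on all subsets of Ω for convenience, but is constrained only on
  -- events.
  record ProbabilitySpace : Set₂ where
    field
      Ω            : Set
      Event        : Pred (Pred Ω 0ℓ) (lsuc 0ℓ)
      Event-U      : Event U
      Event-∁      : ∀ {A} → Event A → Event (∁ A)
      Event-⋃      : ∀ {A : ℕ → Pred Ω 0ℓ} →
                     (∀ i → Event (A i)) → Event (λ ω → ∃ λ i → A i ω)
      Event-resp-≐ : ∀ {A B} → A ≐ B → Event A → Event B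

      P            : Pred Ω 0ℓ → Carrier
      P-cong       : ∀ {A B} → Event A → A ≐ B → P A ≈ P B
      P-nonneg     : ∀ {A} → Event A → 0# ≤ P A
      P-U          : P U ≈ 1#
      P-⋃          : ∀ {A : ℕ → Pred Ω 0ℓ} → (∀ i → Event (A i)) →
                     (∀ {i j} → i ≢ j → A i ⊥ A j) →
                     (λ n → sum {n} λ i → P (A (toℕ i)))
                       ⟶ P (λ ω → ∃ λ i → A i ω)

open ProbabilitySpace ⦃ ... ⦄ public using (Ω; Event; P)

module _ ⦃ ℝ : Reals ⦄ ⦃ 𝒫 : ProbabilitySpace ⦄ where

  IsRandomVariable : Pred (Ω → Carrier) (lsuc 0ℓ)
  IsRandomVariable X = ∀ {B} → Borel B → Event (X ⊢ B)

  Independent : ∀ {n} → (Fin n → Ω → Carrier) → Set₁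
  Independent {n} X =
    (B : Fin n → Pred Carrier 0ℓ) → (∀ i → Borel (B i)) →
    P (λ ω → ∀ i → X i ω ∈ B i) ≈ product (λ i → P (X i ⊢ B i))

  infix 4 _∼b_

  _∼b_ : (Ω → Carrier) → Carrier → Set
  X ∼b p = P (λ ω → X ω ≈ 1#) ≈ p × P (λ ω → X ω ≈ 0#) ≈ 1# - p

{-# OPTIONS --safe #-}
module Submission where

-- Chernoff's method: tilting each Xᵢ by t = 1 + δ gives
-- P (S ≥ rn) ≤ t^(-rn) (1 - p + tp)ⁿ, and 1 - p + tp = 1 + (r - p) ≤ e^(r - p).
-- Independence is only given for product sets, so the tilting is applied to each
-- atom {X = b}, b ∈ {0,1}ⁿ, instead of to an expectation.
-- The laws of exp and log are derived from exp x = lim (1 + x/n)ⁿ and Bernoulli's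
-- inequality.  Order and equality of reals are decidable, hence stable, so that
-- every existential of the analysis is needed only under a double negation.

open import Defs
  using ( Reals; ProbabilitySpace; exp; log; _^ᵣ_; _⟶_; IsRandomVariable; Independent; _∼b_
        ; Borel; half-line; complement; union; resp-≐ )
open import Algebra.Bundles using (CommutativeRing)
import Algebra.Properties.CommutativeSemiring.Exp as Exp
import Algebra.Properties.Monoid.Sum as Sum
import Algebra.Solver.Ring
open import Algebra.Solver.Ring.AlmostCommutativeRing
  using (fromCommutativeRing; _-Raw-AlmostCommutative⟶_)
open import Data.Bool.Base using (Bool; true; false)
open import Data.Fin.Base using (Fin; zero; suc; toℕ)
import Data.Fin.Properties as Fin
open import Data.Integer.Base as ℤ using (ℤ; +_; -[1+_]; _⊖_)
import Data.Integer.Properties as ℤ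
open import Data.Maybe.Base using (Maybe; map)
open import Data.Nat.Base as ℕ using (ℕ; zero; suc)
import Data.Nat.Properties as ℕ
open import Data.Product.Base using (∃; _×_; _,_; proj₁; proj₂)
import Data.Sign.Base as Sign
open import Data.Sum.Base using (inj₁; inj₂; [_,_])
open import Data.Unit.Base using (tt)
open import Data.Vec.Functional using (_∷_)
open import Function.Base using (_∘_)
open import Level using (0ℓ)
open import Relation.Binary.Bundles using (StrictTotalOrder)
open import Relation.Binary.Definitions using (tri<; tri≈; tri>)
import Relation.Binary.Properties.StrictTotalOrder as StrictTotalOrderProperties
open import Relation.Binary.PropositionalEquality.Core as ≡ using (_≢_)
import Relation.Binary.Reasoning.Setoid as SetoidReasoning
import Relation.Binary.Reasoning.StrictPartialOrder as StrictPartialOrderReasoning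
open import Relation.Nullary.Decidable
  using (yes; no; decidable-stable; dec⇒maybe; _×-dec_; ¬?)
open import Relation.Nullary.Negation using (¬_; contradiction)
open import Relation.Unary
  using (Pred; Decidable; Satisfiable; _∈_; _≐_; _⊆_; _⊥_; _∪_; _∩_; ∁; U; ∅)

-- The choice t = 1 + δ minimises t^(-r) e^(p(t - 1)), the bound per trial once 1 - p + tp is
-- replaced by e^(p(t - 1)). The minimum is e^(r - p) (1 + δ)^(-r), of which both closed forms are
-- rewritings. Three obstacles shape the rest. `exp` is given as a supremum of eventual lower
-- bounds, so even its compatibility with `_≈_` has to be proved; its approximants increase once
-- their bases are positive, and the functional equation is extracted from the single inequality 1 ≤
-- e^x e^y e^z for x + y + z = 0, once e^x e^(-x) ≤ 1 and 1 + x ≤ e^x are known. A variable with law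
-- b(p) takes the values 0 and 1 only almost surely, so the atoms cover Ω only up to a null set.
-- Events are assumed closed under complement and countable union alone, so {S ≥ rn} is shown
-- measurable by way of the rationals, and intersections and case splits are confined to decidable
-- events.

-- A ring solver with integer coefficients

module IntegerSolver {c ℓ} (R : CommutativeRing c ℓ) where
  open CommutativeRing R
  open import Algebra.Properties.Semiring.Mult.TCOptimised semiring
    using (×-homo-+; ×1-homo-*; 1+×) renaming (_×_ to _×′_)
  open import Algebra.Properties.Ring ring
    using (-0#≈0#; -‿involutive; -‿+-comm; -‿distribˡ-*; -‿distribʳ-*)
  open SetoidReasoning setoid

  -- The multiple `_×′_` satisfies 1 ×′ x = x by definition, so `con (+ 1)` denotes `1#` itself and
  -- solved equations fit goals that mention `1#`.
  fromℤ : ℤ → Carrier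
  fromℤ (+ n)    = n ×′ 1#
  fromℤ -[1+ n ] = - (suc n ×′ 1#)

  ⊖-homo : ∀ m n → fromℤ (m ⊖ n) ≈ m ×′ 1# - n ×′ 1#
  ⊖-homo m zero = begin
    m ×′ 1#           ≈⟨ +-identityʳ _ ⟨
    m ×′ 1# + 0#      ≈⟨ +-congˡ -0#≈0# ⟨
    m ×′ 1# - 0#      ∎
  ⊖-homo zero (suc n) = sym (+-identityˡ _)
  ⊖-homo (suc m) (suc n) rewrite ℤ.[1+m]⊖[1+n]≡m⊖n m n = begin
    fromℤ (m ⊖ n)                              ≈⟨ ⊖-homo m n ⟩
    m ×′ 1# - n ×′ 1#                          ≈⟨ +-congˡ (+-identityˡ _) ⟨
    m ×′ 1# + (0# - n ×′ 1#)                   ≈⟨ +-congˡ (+-congʳ (-‿inverseʳ 1#)) ⟨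
    m ×′ 1# + ((1# - 1#) - n ×′ 1#)            ≈⟨ +-congˡ (+-assoc _ _ _) ⟩
    m ×′ 1# + (1# + (- 1# - n ×′ 1#))          ≈⟨ +-assoc _ _ _ ⟨
    m ×′ 1# + 1# + (- 1# - n ×′ 1#)            ≈⟨ +-congˡ (-‿+-comm _ _) ⟩
    m ×′ 1# + 1# - (1# + n ×′ 1#)              ≈⟨ +-congʳ (+-comm _ _) ⟩
    1# + m ×′ 1# - (1# + n ×′ 1#)              ≈⟨ +-cong (1+× m 1#) (-‿cong (1+× n 1#)) ⟨
    suc m ×′ 1# - suc n ×′ 1#                  ∎

  +◃-homo : ∀ n → fromℤ (Sign.+ ℤ.◃ n) ≈ n ×′ 1#
  +◃-homo zero    = refl
  +◃-homo (suc n) = refl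

  -◃-homo : ∀ n → fromℤ (Sign.- ℤ.◃ n) ≈ - (n ×′ 1#)
  -◃-homo zero    = sym -0#≈0#
  -◃-homo (suc n) = refl

  +-homo : ∀ i j → fromℤ (i ℤ.+ j) ≈ fromℤ i + fromℤ j
  +-homo (+ m)    (+ n)    = ×-homo-+ 1# m n
  +-homo (+ m)    -[1+ n ] = ⊖-homo m (suc n)
  +-homo -[1+ m ] (+ n)    = trans (⊖-homo n (suc m)) (+-comm _ _)
  +-homo -[1+ m ] -[1+ n ] = begin
    - (suc (suc (m ℕ.+ n)) ×′ 1#)    ≡⟨ ≡.cong (λ k → - (suc k ×′ 1#)) (≡.sym (ℕ.+-suc m n)) ⟩
    - ((suc m ℕ.+ suc n) ×′ 1#)      ≈⟨ -‿cong (×-homo-+ 1# (suc m) (suc n)) ⟩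
    - (suc m ×′ 1# + suc n ×′ 1#)    ≈⟨ -‿+-comm _ _ ⟨
    - (suc m ×′ 1#) - suc n ×′ 1#    ∎

  *-homo : ∀ i j → fromℤ (i ℤ.* j) ≈ fromℤ i * fromℤ j
  *-homo (+ m)    (+ n)    = trans (+◃-homo (m ℕ.* n)) (×1-homo-* m n)
  *-homo (+ m)    -[1+ n ] = begin
    fromℤ (Sign.- ℤ.◃ m ℕ.* suc n)  ≈⟨ -◃-homo (m ℕ.* suc n) ⟩
    - ((m ℕ.* suc n) ×′ 1#)         ≈⟨ -‿cong (×1-homo-* m (suc n)) ⟩
    - (m ×′ 1# * suc n ×′ 1#)       ≈⟨ -‿distribʳ-* _ _ ⟩
    m ×′ 1# * - (suc n ×′ 1#)       ∎
  *-homo -[1+ m ] (+ n)    = begin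
    fromℤ (Sign.- ℤ.◃ suc m ℕ.* n)  ≈⟨ -◃-homo (suc m ℕ.* n) ⟩
    - ((suc m ℕ.* n) ×′ 1#)         ≈⟨ -‿cong (×1-homo-* (suc m) n) ⟩
    - (suc m ×′ 1# * n ×′ 1#)       ≈⟨ -‿distribˡ-* _ _ ⟩
    - (suc m ×′ 1#) * n ×′ 1#       ∎
  *-homo -[1+ m ] -[1+ n ] = begin
    (suc m ℕ.* suc n) ×′ 1#              ≈⟨ ×1-homo-* (suc m) (suc n) ⟩
    suc m ×′ 1# * suc n ×′ 1#            ≈⟨ -‿involutive _ ⟨
    - - (suc m ×′ 1# * suc n ×′ 1#)      ≈⟨ -‿cong (-‿distribʳ-* _ _) ⟩
    - (suc m ×′ 1# * - (suc n ×′ 1#))    ≈⟨ -‿distribˡ-* _ _ ⟩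
    - (suc m ×′ 1#) * - (suc n ×′ 1#)    ∎

  -‿homo : ∀ i → fromℤ (ℤ.- i) ≈ - fromℤ i
  -‿homo (+ zero)    = sym -0#≈0#
  -‿homo (+ suc n)   = refl
  -‿homo -[1+ n ]    = sym (-‿involutive _)

  fromℤ-homo : ℤ.+-*-rawRing -Raw-AlmostCommutative⟶ fromCommutativeRing R
  fromℤ-homo = record
    { ⟦_⟧ = fromℤ ; +-homo = +-homo ; *-homo = *-homo ; -‿homo = -‿homo
    ; 0-homo = refl ; 1-homo = refl }

  coefficient≟ : ∀ i j → Maybe (fromℤ i ≈ fromℤ j)
  coefficient≟ i j = map (λ { ≡.refl → refl }) (dec⇒maybe (i ℤ.≟ j))

  open Algebra.Solver.Ring ℤ.+-*-rawRing (fromCommutativeRing R)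
    fromℤ-homo coefficient≟ public
    using (solve; _:=_; _:+_; _:*_; _:-_; :-_; con)

-- Ordered field arithmetic and Bernoulli's inequality

module OrderedField (ℝ : Reals) where

  open Reals ℝ public hiding (zero)
  open IntegerSolver commutativeRing public
    using (solve; _:=_; _:+_; _:*_; _:-_; :-_; con)

  strictTotalOrder : StrictTotalOrder _ _ _
  strictTotalOrder = record { isStrictTotalOrder = isStrictTotalOrder }

  open StrictTotalOrder strictTotalOrder public
    using (compare; _≟_; strictPartialOrder; <-respʳ-≈; <-respˡ-≈)
    renaming (irrefl to <-irrefl; asym to <-asym)
  open StrictTotalOrderProperties strictTotalOrder public
    using (_≤?_; ≤-respʳ-≈; ≤-respˡ-≈)
    renaming ( antisym to ≤-antisym; total to ≤-total; trans to ≤-trans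
             ; refl to ≤-refl; reflexive to ≤-reflexive )

  <⇒≤ : ∀ {x y} → x < y → x ≤ y
  <⇒≤ = inj₁

  <⇒≱ : ∀ {x y} → x < y → ¬ y ≤ x
  <⇒≱ x<y (inj₁ y<x) = <-asym x<y y<x
  <⇒≱ x<y (inj₂ y≈x) = <-irrefl (sym y≈x) x<y

  ≮⇒≥ : ∀ {x y} → ¬ x < y → y ≤ x
  ≮⇒≥ {x} {y} x≮y with compare x y
  ... | tri< x<y _ _ = contradiction x<y x≮y
  ... | tri≈ _ x≈y _ = inj₂ (sym x≈y)
  ... | tri> _ _ y<x = inj₁ y<x

  ≰⇒> : ∀ {x y} → ¬ x ≤ y → y < x
  ≰⇒> {x} {y} x≰y with compare x y
  ... | tri< x<y _ _ = contradiction (inj₁ x<y) x≰y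
  ... | tri≈ _ x≈y _ = contradiction (inj₂ x≈y) x≰y
  ... | tri> _ _ y<x = y<x

  ≤-stable : ∀ {x y} → ¬ ¬ x ≤ y → x ≤ y
  ≤-stable {x} {y} = decidable-stable (x ≤? y)

  module ≤-Reasoning = StrictPartialOrderReasoning strictPartialOrder

  +-monoʳ-≤ : ∀ x {y z} → y ≤ z → x + y ≤ x + z
  +-monoʳ-≤ x (inj₁ y<z) = inj₁ (+-monoʳ-< x y<z)
  +-monoʳ-≤ x (inj₂ y≈z) = inj₂ (+-congˡ y≈z)

  +-monoˡ-≤ : ∀ x {y z} → y ≤ z → y + x ≤ z + x
  +-monoˡ-≤ x {y} {z} y≤z = begin
    y + x  ≈⟨ +-comm y x ⟩
    x + y  ≤⟨ +-monoʳ-≤ x y≤z ⟩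
    x + z  ≈⟨ +-comm x z ⟩
    z + x  ∎
    where open ≤-Reasoning

  +-mono-≤ : ∀ {x y u v} → x ≤ y → u ≤ v → x + u ≤ y + v
  +-mono-≤ {y = y} {u} x≤y u≤v = ≤-trans (+-monoˡ-≤ u x≤y) (+-monoʳ-≤ y u≤v)

  +-nonneg : ∀ {x y} → 0# ≤ x → 0# ≤ y → 0# ≤ x + y
  +-nonneg 0≤x 0≤y = ≤-respˡ-≈ (+-identityˡ 0#) (+-mono-≤ 0≤x 0≤y)

  +-pos-nonneg : ∀ {x y} → 0# < x → 0# ≤ y → 0# < x + y
  +-pos-nonneg {x} {y} 0<x 0≤y = begin-strict
    0#      <⟨ 0<x ⟩
    x       ≈⟨ +-identityʳ x ⟨
    x + 0#  ≤⟨ +-monoʳ-≤ x 0≤y ⟩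
    x + y   ∎
    where open ≤-Reasoning

  *-nonneg : ∀ {x y} → 0# ≤ x → 0# ≤ y → 0# ≤ x * y
  *-nonneg (inj₁ 0<x) (inj₁ 0<y) = inj₁ (*-pos 0<x 0<y)
  *-nonneg (inj₁ _)   (inj₂ 0≈y) = inj₂ (trans (sym (zeroʳ _)) (*-congˡ 0≈y))
  *-nonneg (inj₂ 0≈x) _          = inj₂ (trans (sym (zeroˡ _)) (*-congʳ 0≈x))

  <-by : ∀ {x y} d → 0# < d → y ≈ x + d → x < y
  <-by {x} {y} d 0<d y≈x+d = begin-strict
    x       ≈⟨ +-identityʳ x ⟨
    x + 0#  <⟨ +-monoʳ-< x 0<d ⟩
    x + d   ≈⟨ y≈x+d ⟨
    y       ∎
    where open ≤-Reasoning

  ≤-by : ∀ {x y} d → 0# ≤ d → y ≈ x + d → x ≤ y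
  ≤-by {x} {y} d 0≤d y≈x+d = begin
    x       ≈⟨ +-identityʳ x ⟨
    x + 0#  ≤⟨ +-monoʳ-≤ x 0≤d ⟩
    x + d   ≈⟨ y≈x+d ⟨
    y       ∎
    where open ≤-Reasoning

  <⇒0<- : ∀ {x y} → x < y → 0# < y - x
  <⇒0<- {x} {y} x<y = begin-strict
    0#       ≈⟨ -‿inverseˡ x ⟨
    - x + x  <⟨ +-monoʳ-< (- x) x<y ⟩
    - x + y  ≈⟨ +-comm (- x) y ⟩
    y - x    ∎
    where open ≤-Reasoning

  ≤⇒0≤- : ∀ {x y} → x ≤ y → 0# ≤ y - x
  ≤⇒0≤- {x} {y} (inj₁ x<y) = inj₁ (<⇒0<- x<y)
  ≤⇒0≤- {x} {y} (inj₂ x≈y) = inj₂ (trans (sym (-‿inverseʳ x)) (+-congʳ x≈y))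

  neg-mono-≤ : ∀ {x y} → x ≤ y → - y ≤ - x
  neg-mono-≤ {x} {y} x≤y = ≤-by (y - x) (≤⇒0≤- x≤y)
    (solve 2 (λ x y → :- x := :- y :+ (y :- x)) refl x y)

  *-monoʳ-≤ : ∀ {z} → 0# ≤ z → ∀ {x y} → x ≤ y → z * x ≤ z * y
  *-monoʳ-≤ {z} 0≤z {x} {y} x≤y = ≤-by (z * (y - x)) (*-nonneg 0≤z (≤⇒0≤- x≤y))
    (solve 3 (λ x y z → z :* y := z :* x :+ z :* (y :- x)) refl x y z)

  *-monoʳ-< : ∀ {z} → 0# < z → ∀ {x y} → x < y → z * x < z * y
  *-monoʳ-< {z} 0<z {x} {y} x<y = <-by (z * (y - x)) (*-pos 0<z (<⇒0<- x<y))
    (solve 3 (λ x y z → z :* y := z :* x :+ z :* (y :- x)) refl x y z)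

  *-mono-≤ : ∀ {x y u v} → 0# ≤ x → 0# ≤ u → x ≤ y → u ≤ v → x * u ≤ y * v
  *-mono-≤ {x} {y} {u} {v} 0≤x 0≤u x≤y u≤v = begin
    x * u  ≤⟨ *-monoʳ-≤ 0≤x u≤v ⟩
    x * v  ≈⟨ *-comm x v ⟩
    v * x  ≤⟨ *-monoʳ-≤ (≤-trans 0≤u u≤v) x≤y ⟩
    v * y  ≈⟨ *-comm v y ⟩
    y * v  ∎
    where open ≤-Reasoning

  *-monoˡ-≤ : ∀ {z} → 0# ≤ z → ∀ {x y} → x ≤ y → x * z ≤ y * z
  *-monoˡ-≤ {z} 0≤z {x} {y} x≤y =
    ≤-respˡ-≈ (*-comm z x) (≤-respʳ-≈ (*-comm z y) (*-monoʳ-≤ 0≤z x≤y))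

  *-cancelˡ-≤ : ∀ {z} → 0# < z → ∀ {x y} → z * x ≤ z * y → x ≤ y
  *-cancelˡ-≤ 0<z zx≤zy = ≮⇒≥ λ y<x → <⇒≱ (*-monoʳ-< 0<z y<x) zx≤zy

  *-cancelˡ-< : ∀ {z} → 0# < z → ∀ {x y} → z * x < z * y → x < y
  *-cancelˡ-< 0<z zx<zy = ≰⇒> λ y≤x → <⇒≱ zx<zy (*-monoʳ-≤ (<⇒≤ 0<z) y≤x)

  *-cancelˡ-≈ : ∀ {z} → 0# < z → ∀ {x y} → z * x ≈ z * y → x ≈ y
  *-cancelˡ-≈ 0<z zx≈zy =
    ≤-antisym (*-cancelˡ-≤ 0<z (inj₂ zx≈zy)) (*-cancelˡ-≤ 0<z (inj₂ (sym zx≈zy)))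

  0≤x² : ∀ x → 0# ≤ x * x
  0≤x² x with ≤-total 0# x
  ... | inj₁ 0≤x = *-nonneg 0≤x 0≤x
  ... | inj₂ x≤0 = ≤-respʳ-≈
    (solve 1 (λ x → (con (+ 0) :- x) :* (con (+ 0) :- x) := x :* x) refl x)
    (*-nonneg (≤⇒0≤- x≤0) (≤⇒0≤- x≤0))

  0<1 : 0# < 1#
  0<1 with 0≤x² 1#
  ... | inj₁ 0<1*1 = <-respʳ-≈ (*-identityˡ 1#) 0<1*1
  ... | inj₂ 0≈1*1 = contradiction (trans 0≈1*1 (*-identityˡ 1#)) 0≉1

  0≤1 : 0# ≤ 1#
  0≤1 = <⇒≤ 0<1

  pos⇒≉0 : ∀ {x} → 0# < x → x ≉ 0#
  pos⇒≉0 0<x x≈0 = <-irrefl (sym x≈0) 0<x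

  pos⇒x*x⁻¹≈1 : ∀ {x} → 0# < x → x * x ⁻¹ ≈ 1#
  pos⇒x*x⁻¹≈1 0<x = ⁻¹-inverseʳ _ (pos⇒≉0 0<x)

  ⁻¹-pos : ∀ {x} → 0# < x → 0# < x ⁻¹
  ⁻¹-pos {x} 0<x = *-cancelˡ-< 0<x
    (<-respˡ-≈ (sym (zeroʳ x)) (<-respʳ-≈ (sym (pos⇒x*x⁻¹≈1 0<x)) 0<1))

  ⁻¹-unique : ∀ {x y} → 0# < x → x * y ≈ 1# → x ⁻¹ ≈ y
  ⁻¹-unique 0<x xy≈1 = *-cancelˡ-≈ 0<x (trans (pos⇒x*x⁻¹≈1 0<x) (sym xy≈1))

  ^-nonneg : ∀ {x} → 0# ≤ x → ∀ n → 0# ≤ x ^ n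
  ^-nonneg 0≤x zero    = 0≤1
  ^-nonneg 0≤x (suc n) = *-nonneg 0≤x (^-nonneg 0≤x n)

  ^-pos : ∀ {x} → 0# < x → ∀ n → 0# < x ^ n
  ^-pos 0<x zero    = 0<1
  ^-pos 0<x (suc n) = *-pos 0<x (^-pos 0<x n)

  ^-mono-≤ : ∀ {x y} → 0# ≤ x → x ≤ y → ∀ n → x ^ n ≤ y ^ n
  ^-mono-≤ 0≤x x≤y zero    = ≤-refl
  ^-mono-≤ 0≤x x≤y (suc n) = *-mono-≤ 0≤x (^-nonneg 0≤x n) x≤y (^-mono-≤ 0≤x x≤y n)

  1^n≈1 : ∀ n → 1# ^ n ≈ 1#
  1^n≈1 zero    = refl
  1^n≈1 (suc n) = trans (*-identityˡ _) (1^n≈1 n)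

  fromℕ-nonneg : ∀ n → 0# ≤ fromℕ n
  fromℕ-nonneg zero    = ≤-refl
  fromℕ-nonneg (suc n) = +-nonneg 0≤1 (fromℕ-nonneg n)

  fromℕ-suc-pos : ∀ n → 0# < fromℕ (suc n)
  fromℕ-suc-pos n = +-pos-nonneg 0<1 (fromℕ-nonneg n)

  fromℕ-mono-≤ : ∀ {m n} → m ℕ.≤ n → fromℕ m ≤ fromℕ n
  fromℕ-mono-≤ {n = n} ℕ.z≤n = fromℕ-nonneg n
  fromℕ-mono-≤ (ℕ.s≤s m≤n)  = +-monoʳ-≤ 1# (fromℕ-mono-≤ m≤n)

  -- The tangent to aⁿ⁺¹ at b lies below the graph.
  tangent-≤ : ∀ {a b} → 0# ≤ a → 0# ≤ b → ∀ n →
              b ^ n * (b + fromℕ (suc n) * (a - b)) ≤ a ^ suc n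
  tangent-≤ {a} {b} 0≤a 0≤b zero = ≤-reflexive
    (solve 2 (λ a b → con (+ 1) :* (b :+ (con (+ 1) :+ con (+ 0)) :* (a :- b)) := a :* con (+ 1))
      refl a b)
  tangent-≤ {a} {b} 0≤a 0≤b (suc n) = begin
    b * b ^ n * (b + (1# + N) * (a - b))
      -- `a` times the previous tangent exceeds the new tangent by exactly this multiple of (a -
      -- b)².
      ≤⟨ ≤-by (b ^ n * (N * ((a - b) * (a - b))))
           (*-nonneg (^-nonneg 0≤b n) (*-nonneg (fromℕ-nonneg (suc n)) (0≤x² (a - b))))
           (solve 4 (λ a b N B →
              a :* (B :* (b :+ N :* (a :- b))) :=
              b :* B :* (b :+ (con (+ 1) :+ N) :* (a :- b))
                :+ B :* (N :* ((a :- b) :* (a :- b))))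
             refl a b N (b ^ n)) ⟩
    a * (b ^ n * (b + N * (a - b)))
      ≤⟨ *-monoʳ-≤ 0≤a (tangent-≤ 0≤a 0≤b n) ⟩
    a * a ^ suc n ∎
    where
    open ≤-Reasoning
    N = fromℕ (suc n)

  bernoulli : ∀ {h} → 0# ≤ 1# + h → ∀ n → 1# + fromℕ (suc n) * h ≤ (1# + h) ^ suc n
  bernoulli {h} 0≤1+h n = begin
    1# + N * h                                 ≈⟨ solve 2 (λ N h →
       con (+ 1) :+ N :* h := con (+ 1) :* (con (+ 1) :+ N :* (con (+ 1) :+ h :- con (+ 1))))
        refl N h ⟩
    1# * (1# + N * (1# + h - 1#))              ≈⟨ *-congʳ (1^n≈1 n) ⟨
    1# ^ n * (1# + N * (1# + h - 1#))          ≤⟨ tangent-≤ 0≤1+h 0≤1 n ⟩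
    (1# + h) ^ suc n                           ∎
    where
    open ≤-Reasoning
    N = fromℕ (suc n)

-- Suprema and the Archimedean property

module Completeness (ℝ : Reals) where
  open OrderedField ℝ

  ≤-elim : ∀ {A : Set} {x y} → ¬ ¬ A → (A → x ≤ y) → x ≤ y
  ≤-elim ¬¬a f = ≤-stable λ x≰y → ¬¬a λ a → x≰y (f a)

  -- Each half of the conclusion ends in a stable inequality, and while proving it the other witness
  -- is already at hand: a given element in the first half, a given bound in the second.
  sup-lub-¬¬ : ∀ A → ¬ ¬ Satisfiable A → ¬ ¬ Satisfiable (IsUpperBound A) →
               IsLeastUpperBound A (sup A)
  sup-lub-¬¬ A sat bdd =
    (λ x x∈A → ≤-elim bdd λ b → proj₁ (sup-lub A (x , x∈A) b) x x∈A) ,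
    (λ b b-ub → ≤-elim sat λ s → proj₂ (sup-lub A s (b , b-ub)) b b-ub)

  -- If the naturals were bounded, their supremum `s` would remain an upper bound after subtracting
  -- 1, because n + 1 ≤ s gives n ≤ s - 1.
  archimedean : ∀ x → ¬ (∀ n → fromℕ n ≤ x)
  archimedean x bound = <⇒≱ s-1<s (proj₂ lub (s - 1#) s-1-ub)
    where
    A = λ y → ∃ λ n → y ≈ fromℕ n
    s = sup A
    lub : IsLeastUpperBound A s
    lub = sup-lub A (0# , 0 , refl) (x , λ { y (n , y≈n) → ≤-respˡ-≈ (sym y≈n) (bound n) })
    s-1<s : s - 1# < s
    s-1<s = <-by 1# 0<1 (solve 1 (λ s → s := s :- con (+ 1) :+ con (+ 1)) refl s)
    s-1-ub : IsUpperBound A (s - 1#)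
    s-1-ub y (n , y≈n) = begin
      y                   ≈⟨ y≈n ⟩
      fromℕ n             ≈⟨ solve 1 (λ k → k := con (+ 1) :+ k :- con (+ 1)) refl (fromℕ n) ⟩
      fromℕ (suc n) - 1#  ≤⟨ +-monoˡ-≤ (- 1#) (proj₁ lub (fromℕ (suc n)) (suc n , refl)) ⟩
      s - 1#              ∎
      where open ≤-Reasoning

  -- Archimedes only refutes boundedness, hence the double negation; it is
  -- harmless since inequalities are stable.
  Eventually : (ℕ → Set) → Set
  Eventually Q = ¬ ¬ ∃ λ N → ∀ n → N ℕ.≤ n → Q n

  _∩ᵉ_ : ∀ {Q R} → Eventually Q → Eventually R → Eventually (λ n → Q n × R n)
  (evQ ∩ᵉ evR) k = evQ λ (M , q) → evR λ (N , r) → k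
    (M ℕ.⊔ N , λ n M⊔N≤n → q n (ℕ.m⊔n≤o⇒m≤o M N M⊔N≤n) , r n (ℕ.m⊔n≤o⇒n≤o M N M⊔N≤n))

  Eventually⇒¬¬∃ : ∀ {Q} → Eventually Q → ¬ ¬ ∃ Q
  Eventually⇒¬¬∃ ev k = ev λ (N , q) → k (N , q N ℕ.≤-refl)

  eventually-large : ∀ x → Eventually (λ n → x < fromℕ (suc n))
  eventually-large x k = archimedean x λ n → ≮⇒≥ λ x<n → k
    (n , λ m n≤m → begin-strict
      x              <⟨ x<n ⟩
      fromℕ n        ≤⟨ fromℕ-mono-≤ (ℕ.m≤n⇒m≤1+n n≤m) ⟩
      fromℕ (suc m)  ∎)
    where open ≤-Reasoning

-- The exponential as the limit of (1 + x/n)ⁿ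

module Exponential ⦃ ℝ : Reals ⦄ where
  open OrderedField ℝ
  open Completeness ℝ
  open Exp commutativeSemiring using (^-congˡ; ^-distrib-*)

  base approx : Carrier → ℕ → Carrier
  base x n = 1# + x / fromℕ (suc n)
  approx x n = base x n ^ suc n

  private
    ι : ℕ → Carrier
    ι n = fromℕ (suc n) ⁻¹

    0<ι : ∀ n → 0# < ι n
    0<ι n = ⁻¹-pos (fromℕ-suc-pos n)

    nι≈1 : ∀ n → fromℕ (suc n) * ι n ≈ 1#
    nι≈1 n = pos⇒x*x⁻¹≈1 (fromℕ-suc-pos n)

  n*base≈n+x : ∀ x n → fromℕ (suc n) * base x n ≈ fromℕ (suc n) + x
  n*base≈n+x x n = begin-equality
    N * (1# + x * ι n)      ≈⟨ solve 3 (λ N x i →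
        N :* (con (+ 1) :+ x :* i) := N :+ x :* (N :* i)) refl N x (ι n) ⟩
    N + x * (N * ι n)       ≈⟨ +-congˡ (*-congˡ (nι≈1 n)) ⟩
    N + x * 1#              ≈⟨ +-congˡ (*-identityʳ x) ⟩
    N + x                   ∎
    where
    open ≤-Reasoning
    N = fromℕ (suc n)

  0<n+x⇒base-pos : ∀ x n → 0# < fromℕ (suc n) + x → 0# < base x n
  0<n+x⇒base-pos x n 0<n+x = *-cancelˡ-< (fromℕ-suc-pos n)
    (<-respˡ-≈ (sym (zeroʳ _)) (<-respʳ-≈ (sym (n*base≈n+x x n)) 0<n+x))

  base-pos-mono : ∀ x {m n} → m ℕ.≤ n → 0# < base x m → 0# < base x n
  base-pos-mono x {m} {n} m≤n 0<b = 0<n+x⇒base-pos x n (begin-strict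
    0#                        <⟨ *-pos (fromℕ-suc-pos m) 0<b ⟩
    fromℕ (suc m) * base x m  ≈⟨ n*base≈n+x x m ⟩
    fromℕ (suc m) + x         ≤⟨ +-monoˡ-≤ x (fromℕ-mono-≤ (ℕ.s≤s m≤n)) ⟩
    fromℕ (suc n) + x         ∎)
    where open ≤-Reasoning

  -- For negative `x` the early bases can be zero or negative, and the approximants are compared
  -- only where the base is positive; the estimates below all start there.
  eventually-base-pos : ∀ x → Eventually (λ n → 0# < base x n)
  eventually-base-pos x k = eventually-large (- x) λ (N , large) → k
    (N , λ n N≤n → 0<n+x⇒base-pos x n
      (<-respʳ-≈ (solve 2 (λ a x → a :- :- x := a :+ x) refl (fromℕ (suc n)) x)
        (<⇒0<- (large n N≤n))))

  -- The tangent at base x n, evaluated at base x (suc n), is base x n ^ suc n.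
  approx-step : ∀ x n → 0# < base x n → approx x n ≤ approx x (suc n)
  approx-step x n 0<b = begin
    b ^ suc n                               ≈⟨ *-identityʳ _ ⟨
    b ^ suc n * 1#                          ≈⟨ *-congˡ b+N′[a-b]≈1 ⟨
    b ^ suc n * (b + (1# + N) * (a - b))    ≤⟨ tangent-≤ (<⇒≤ 0<a) (<⇒≤ 0<b) (suc n) ⟩
    a ^ suc (suc n)                         ∎
    where
    open ≤-Reasoning
    N = fromℕ (suc n)
    a = base x (suc n)
    b = base x n
    0<a = base-pos-mono x (ℕ.n≤1+n n) 0<b
    b+N′[a-b]≈1 : b + (1# + N) * (a - b) ≈ 1#
    b+N′[a-b]≈1 = begin-equality
      b + (1# + N) * (a - b)     ≈⟨ solve 3 (λ a b N →
          b :+ (con (+ 1) :+ N) :* (a :- b) := (con (+ 1) :+ N) :* a :- N :* b) refl a b N ⟩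
      (1# + N) * a - N * b       ≈⟨ +-cong (n*base≈n+x x (suc n)) (-‿cong (n*base≈n+x x n)) ⟩
      (1# + N) + x - (N + x)     ≈⟨ solve 2 (λ N x →
          con (+ 1) :+ N :+ x :- (N :+ x) := con (+ 1)) refl N x ⟩
      1#                         ∎

  approx-mono : ∀ x {m n} → 0# < base x m → m ℕ.≤ n → approx x m ≤ approx x n
  approx-mono x {m} 0<b m≤n = go (ℕ.≤⇒≤′ m≤n)
    where
    go : ∀ {n} → m ℕ.≤′ n → approx x m ≤ approx x n
    go ℕ.≤′-refl         = ≤-refl
    go (ℕ.≤′-step {n} m≤′n) =
      ≤-trans (go m≤′n) (approx-step x n (base-pos-mono x (ℕ.≤′⇒≤ m≤′n) 0<b))

  -- With y = -x the bases multiply to 1 - (x/N)², which is at most 1.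
  approx-inverse-≤ : ∀ {x y n} → x + y ≈ 0# → 0# < base x n → 0# < base y n →
                     approx x n * approx y n ≤ 1#
  approx-inverse-≤ {x} {y} {n} x+y≈0 0<bx 0<by = begin
    base x n ^ suc n * base y n ^ suc n  ≈⟨ ^-distrib-* _ _ (suc n) ⟨
    (base x n * base y n) ^ suc n        ≤⟨ ^-mono-≤ (*-nonneg (<⇒≤ 0<bx) (<⇒≤ 0<by)) bb≤1 (suc n) ⟩
    1# ^ suc n                           ≈⟨ 1^n≈1 (suc n) ⟩
    1#                                   ∎
    where
    open ≤-Reasoning
    i = ι n
    bb≤1 : base x n * base y n ≤ 1#
    bb≤1 = ≤-by (x * i * (x * i)) (0≤x² (x * i)) (begin-equality
      -- The cofactor `i + x * i * i` collects what multiplies x + y in (1 + x i)(1 + y i) + (x i)².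
      1#                                       ≈⟨ solve 2 (λ x i →
          con (+ 1) := con (+ 1) :+ con (+ 0) :* (i :+ x :* i :* i)) refl x i ⟩
      1# + 0# * (i + x * i * i)                ≈⟨ +-congˡ (*-congʳ x+y≈0) ⟨
      1# + (x + y) * (i + x * i * i)           ≈⟨ solve 3 (λ x y i →
          con (+ 1) :+ (x :+ y) :* (i :+ x :* i :* i) :=
          (con (+ 1) :+ x :* i) :* (con (+ 1) :+ y :* i) :+ x :* i :* (x :* i)) refl x y i ⟩
      base x n * base y n + x * i * (x * i)    ∎)

  private
    EventualLowerBound : Carrier → Pred Carrier 0ℓ
    EventualLowerBound x y = ∃ λ N → ∀ n → N ℕ.≤ n → y ≤ approx x n

  approx-lowerBound : ∀ x n → 0# < base x n → EventualLowerBound x (approx x n)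
  approx-lowerBound x n 0<b = n , λ m n≤m → approx-mono x 0<b n≤m

  -- Boundedness comes from the sequence at `- x`: for m ≥ M, `approx x m` is at most the reciprocal
  -- of `approx (- x) m`, hence at most that of the smaller `approx (- x) M`, which no longer
  -- depends on m.
  exp-lub : ∀ x → IsLeastUpperBound (EventualLowerBound x) (exp x)
  exp-lub x = sup-lub-¬¬ (EventualLowerBound x) inhabited bounded
    where
    inhabited : ¬ ¬ Satisfiable (EventualLowerBound x)
    inhabited k = Eventually⇒¬¬∃ (eventually-base-pos x) λ (n , 0<b) →
      k (approx x n , approx-lowerBound x n 0<b)
    bounded : ¬ ¬ Satisfiable (IsUpperBound (EventualLowerBound x))
    bounded k = (eventually-base-pos x ∩ᵉ eventually-base-pos (- x)) λ (M , 0<b) → k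
      (approx (- x) M ⁻¹ , λ { y (N , y≤) →
        let m     = M ℕ.⊔ N
            M≤m   = ℕ.m≤m⊔n M N
            0<b₊  = proj₁ (0<b m M≤m)
            0<b₋  = proj₂ (0<b m M≤m)
            0<bM  = proj₂ (0<b M ℕ.≤-refl)
            0<c   = ^-pos 0<bM (suc M)
        in *-cancelˡ-≤ 0<c (begin
          approx (- x) M * y
            ≤⟨ *-mono-≤′ 0<c (approx-mono (- x) 0<bM M≤m) (y≤ m (ℕ.m≤n⊔m M N))
                 (^-nonneg (<⇒≤ 0<b₊) (suc m)) ⟩
          approx (- x) m * approx x m
            ≤⟨ approx-inverse-≤ {n = m} (-‿inverseˡ x) 0<b₋ 0<b₊ ⟩
          1#                                    ≈⟨ pos⇒x*x⁻¹≈1 0<c ⟨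
          approx (- x) M * approx (- x) M ⁻¹    ∎) })
      where
      open ≤-Reasoning
      -- Here `y` is an arbitrary eventual lower bound and may be negative, so the sign condition
      -- falls on `z`.
      *-mono-≤′ : ∀ {a b y z} → 0# < a → a ≤ b → y ≤ z → 0# ≤ z → a * y ≤ b * z
      *-mono-≤′ 0<a a≤b y≤z 0≤z =
        ≤-trans (*-monoʳ-≤ (<⇒≤ 0<a) y≤z) (*-monoˡ-≤ 0≤z a≤b)

  approx≤exp : ∀ x n → 0# < base x n → approx x n ≤ exp x
  approx≤exp x n 0<b = proj₁ (exp-lub x) (approx x n) (approx-lowerBound x n 0<b)

  -- Every eventual lower bound lies below an approximant late enough to be past `N` and to have
  -- positive base. Together with `approx≤exp` this makes `exp x` the supremum of its approximants
  -- of positive base.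
  exp-≤ : ∀ {x b} N → (∀ n → N ℕ.≤ n → 0# < base x n → approx x n ≤ b) → exp x ≤ b
  exp-≤ {x} {b} N approx≤b = proj₂ (exp-lub x) b λ { y (M , y≤) →
    ≤-elim (eventually-base-pos x) λ (K , 0<b) →
      let m    = M ℕ.⊔ (N ℕ.⊔ K)
          N⊔K≤m = ℕ.m≤n⊔m M (N ℕ.⊔ K)
      in ≤-trans (y≤ m (ℕ.m≤m⊔n M _))
           (approx≤b m (ℕ.≤-trans (ℕ.m≤m⊔n N K) N⊔K≤m)
             (0<b m (ℕ.≤-trans (ℕ.m≤n⊔m N K) N⊔K≤m))) }

  0<exp : ∀ x → 0# < exp x
  0<exp x = ≰⇒> λ exp≤0 → Eventually⇒¬¬∃ (eventually-base-pos x) λ (n , 0<b) →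
    <⇒≱ (^-pos 0<b (suc n)) (≤-trans (approx≤exp x n 0<b) exp≤0)

  1+x≤exp : ∀ x → 1# + x ≤ exp x
  1+x≤exp x = ≤-elim (Eventually⇒¬¬∃ (eventually-base-pos x)) λ (n , 0<b) → begin
    1# + x                              ≈⟨ +-congˡ (*-identityʳ x) ⟨
    1# + x * 1#                         ≈⟨ +-congˡ (*-congˡ (nι≈1 n)) ⟨
    1# + x * (fromℕ (suc n) * ι n)      ≈⟨ solve 3 (λ x N i →
        con (+ 1) :+ x :* (N :* i) := con (+ 1) :+ N :* (x :* i)) refl x (fromℕ (suc n)) (ι n) ⟩
    1# + fromℕ (suc n) * (x * ι n)      ≤⟨ bernoulli (<⇒≤ 0<b) n ⟩
    approx x n                          ≤⟨ approx≤exp x n 0<b ⟩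
    exp x                               ∎
    where open ≤-Reasoning

  -- The bound on approximants holds at a common index, while the suprema are taken one factor at a
  -- time. So `approx y n` is first fixed and then raised by monotonicity to the index m of the
  -- other factor.
  exp-inverse-≤ : ∀ {x y} → x + y ≈ 0# → exp x * exp y ≤ 1#
  exp-inverse-≤ {x} {y} x+y≈0 = begin
    exp x * exp y       ≤⟨ *-monoʳ-≤ (<⇒≤ (0<exp x)) (exp-≤ 0 λ n _ 0<by →
        *-cancelˡ-≤ (0<exp x) (exp-x*approx-y≤ n 0<by)) ⟩
    exp x * exp x ⁻¹    ≈⟨ pos⇒x*x⁻¹≈1 (0<exp x) ⟩
    1#                  ∎
    where
    open ≤-Reasoning
    exp-x*approx-y≤ : ∀ n → 0# < base y n → exp x * approx y n ≤ exp x * exp x ⁻¹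
    exp-x*approx-y≤ n 0<by = begin
      exp x * c          ≈⟨ *-comm _ c ⟩
      c * exp x          ≤⟨ *-monoʳ-≤ (<⇒≤ 0<c) (exp-≤ n λ m n≤m 0<bx → *-cancelˡ-≤ 0<c (begin
          c * approx x m
            ≤⟨ *-monoˡ-≤ (^-nonneg (<⇒≤ 0<bx) (suc m)) (approx-mono y 0<by n≤m) ⟩
          approx y m * approx x m
            ≤⟨ approx-inverse-≤ {n = m} (trans (+-comm y x) x+y≈0) (base-pos-mono y n≤m 0<by) 0<bx ⟩
          1#                        ≈⟨ pos⇒x*x⁻¹≈1 0<c ⟨
          c * c ⁻¹                  ∎)) ⟩
      c * c ⁻¹           ≈⟨ pos⇒x*x⁻¹≈1 0<c ⟩
      1#                 ≈⟨ pos⇒x*x⁻¹≈1 (0<exp x) ⟨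
      exp x * exp x ⁻¹   ∎
      where
      c = approx y n
      0<c = ^-pos 0<by (suc n)

  -- By Bernoulli, exp x * exp y * exp z ≥ (1 + c / N² + d / N³) ^ N ≥ 1 + c / N + d / N²,
  -- where c = x y + y z + z x and d = x y z.
  1≤exp-triple : ∀ {x y z} → x + y + z ≈ 0# → 1# ≤ exp x * exp y * exp z
  1≤exp-triple {x} {y} {z} x+y+z≈0 = ≮⇒≥ λ T<1 →
    let 0<1-T = <⇒0<- T<1 in
    -- N > -d bounds the term -d / N by 1, so `deficit` gives (1 - T) N ≤ 1 - c; N beyond the second
    -- threshold (1 - c) / (1 - T) contradicts this.
    Eventually⇒¬¬∃ (eventually-base-pos x ∩ᵉ (eventually-base-pos y ∩ᵉ (eventually-base-pos z
      ∩ᵉ (eventually-large (- d) ∩ᵉ eventually-large ((1# - c) * (1# - T) ⁻¹)))))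
      λ (n , 0<bx , 0<by , 0<bz , -d<N , k<N) →
        let N = fromℕ (suc n)
        in <⇒≱ (begin-strict
          1# - c                                ≈⟨ *-identityʳ _ ⟨
          (1# - c) * 1#                         ≈⟨ *-congˡ (pos⇒x*x⁻¹≈1 0<1-T) ⟨
          (1# - c) * ((1# - T) * (1# - T) ⁻¹)
            ≈⟨ solve 3 (λ a b e → a :* (b :* e) := b :* (a :* e)) refl (1# - c) (1# - T) _ ⟩
          (1# - T) * ((1# - c) * (1# - T) ⁻¹)   <⟨ *-monoʳ-< 0<1-T k<N ⟩
          (1# - T) * N                          ∎)
          (deficit n (<⇒≤ -d<N) 0<bx 0<by 0<bz)
    where
    open ≤-Reasoning
    T = exp x * exp y * exp z
    c = x * y + y * z + z * x
    d = x * y * z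
    deficit : ∀ n → - d ≤ fromℕ (suc n) →
              0# < base x n → 0# < base y n → 0# < base z n →
              (1# - T) * fromℕ (suc n) ≤ 1# - c
    deficit n -d≤N 0<bx 0<by 0<bz = begin
      (1# - T) * N
        ≤⟨ *-monoˡ-≤ (fromℕ-nonneg (suc n)) (+-monoʳ-≤ 1# (neg-mono-≤ 1+Nh≤T)) ⟩
      (1# - (1# + N * h)) * N   ≈⟨ solve 4 (λ N i c d →
          (con (+ 1) :- (con (+ 1) :+ N :* (i :* (c :* i :+ d :* i :* i)))) :* N :=
          N :* i :* (N :* i) :* ((:- d) :* i :- c)) refl N i c d ⟩
      N * i * (N * i) * ((- d) * i - c)   ≈⟨ *-congʳ (*-cong (nι≈1 n) (nι≈1 n)) ⟩
      1# * 1# * ((- d) * i - c)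
        ≈⟨ solve 1 (λ e → con (+ 1) :* con (+ 1) :* e := e) refl _ ⟩
      (- d) * i - c             ≤⟨ +-monoˡ-≤ (- c) (*-monoˡ-≤ (<⇒≤ (0<ι n)) -d≤N) ⟩
      N * i - c                 ≈⟨ +-congʳ (nι≈1 n) ⟩
      1# - c                    ∎
      where
      N = fromℕ (suc n)
      i = ι n
      h = i * (c * i + d * i * i)
      bbb = base x n * base y n * base z n
      0<bbb = *-pos (*-pos 0<bx 0<by) 0<bz
      bbb≈1+h : bbb ≈ 1# + h
      bbb≈1+h = begin-equality
        bbb                             ≈⟨ solve 4 (λ x y z i →
            (con (+ 1) :+ x :* i) :* (con (+ 1) :+ y :* i) :* (con (+ 1) :+ z :* i) :=
            (x :+ y :+ z) :* i :+ (con (+ 1) :+ i :*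
              ((x :* y :+ y :* z :+ z :* x) :* i :+ x :* y :* z :* i :* i))) refl x y z i ⟩
        (x + y + z) * i + (1# + h)      ≈⟨ +-congʳ (*-congʳ x+y+z≈0) ⟩
        0# * i + (1# + h)               ≈⟨ +-congʳ (zeroˡ i) ⟩
        0# + (1# + h)                   ≈⟨ +-identityˡ _ ⟩
        1# + h                          ∎
      1+Nh≤T : 1# + N * h ≤ T
      1+Nh≤T = begin
        1# + N * h              ≤⟨ bernoulli (≤-respʳ-≈ bbb≈1+h (<⇒≤ 0<bbb)) n ⟩
        (1# + h) ^ suc n        ≈⟨ ^-congˡ (suc n) bbb≈1+h ⟨
        bbb ^ suc n             ≈⟨ ^-distrib-* _ _ (suc n) ⟩
        (base x n * base y n) ^ suc n * approx z n   ≈⟨ *-congʳ (^-distrib-* _ _ (suc n)) ⟩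
        approx x n * approx y n * approx z n
          ≤⟨ *-mono-≤ (*-nonneg 0≤ax 0≤ay) (^-nonneg (<⇒≤ 0<bz) (suc n))
               (*-mono-≤ 0≤ax 0≤ay (approx≤exp x n 0<bx) (approx≤exp y n 0<by))
               (approx≤exp z n 0<bz) ⟩
        T                       ∎
        where
        0≤ax = ^-nonneg (<⇒≤ 0<bx) (suc n)
        0≤ay = ^-nonneg (<⇒≤ 0<by) (suc n)

-- The laws of exponential and logarithm

module ExpLog ⦃ ℝ : Reals ⦄ where
  open OrderedField ℝ
  open Exponential

  -- Since 0 is its own negative, e = `exp 0#` satisfies e² ≤ 1 ≤ e, and cancelling e gives e ≤ 1.
  exp-0≈1 : exp 0# ≈ 1#
  exp-0≈1 = ≤-antisym
    (*-cancelˡ-≤ (0<exp 0#) (begin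
      exp 0# * exp 0#  ≤⟨ exp-inverse-≤ (+-identityˡ 0#) ⟩
      1#               ≈⟨ +-identityʳ 1# ⟨
      1# + 0#          ≤⟨ 1+x≤exp 0# ⟩
      exp 0#           ≈⟨ *-identityʳ _ ⟨
      exp 0# * 1#      ∎))
    (≤-respˡ-≈ (+-identityʳ 1#) (1+x≤exp 0#))
    where open ≤-Reasoning

  exp-inverse : ∀ {x y} → x + y ≈ 0# → exp x * exp y ≈ 1#
  exp-inverse {x} {y} x+y≈0 = ≤-antisym (exp-inverse-≤ x+y≈0) (begin
    1#                       ≤⟨ 1≤exp-triple (trans (+-identityʳ _) x+y≈0) ⟩
    exp x * exp y * exp 0#   ≈⟨ *-congˡ exp-0≈1 ⟩
    exp x * exp y * 1#       ≈⟨ *-identityʳ _ ⟩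
    exp x * exp y            ∎)
    where open ≤-Reasoning

  -- Both sides are inverse to `exp (- x)`. This works because the inverse law is stated for any two
  -- numbers whose sum is ≈ 0, and not just for `x` and `- x`.
  exp-cong : ∀ {x y} → x ≈ y → exp x ≈ exp y
  exp-cong {x} {y} x≈y = *-cancelˡ-≈ (0<exp (- x))
    (trans (exp-inverse (-‿inverseˡ x))
      (sym (exp-inverse (trans (+-congˡ (sym x≈y)) (-‿inverseˡ x)))))

  exp-+-≤ : ∀ x y → exp (x + y) ≤ exp x * exp y
  exp-+-≤ x y = begin
    exp (x + y)                                      ≈⟨ *-identityʳ _ ⟨
    exp (x + y) * 1#
      ≤⟨ *-monoʳ-≤ (<⇒≤ (0<exp _)) (1≤exp-triple (-‿inverseʳ (x + y))) ⟩
    exp (x + y) * (exp x * exp y * exp (- (x + y)))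
      ≈⟨ solve 3 (λ s p m → s :* (p :* m) := s :* m :* p) refl _ (exp x * exp y) _ ⟩
    exp (x + y) * exp (- (x + y)) * (exp x * exp y)  ≈⟨ *-congʳ (exp-inverse (-‿inverseʳ (x + y))) ⟩
    1# * (exp x * exp y)                             ≈⟨ *-identityˡ _ ⟩
    exp x * exp y                                    ∎
    where open ≤-Reasoning

  -- The inequality exp-+-≤ at - x and - y is inverted into its converse at x and y.
  exp-+ : ∀ x y → exp (x + y) ≈ exp x * exp y
  exp-+ x y = ≤-antisym (exp-+-≤ x y) (begin
    exp x * exp y                                          ≈⟨ *-identityʳ _ ⟨
    exp x * exp y * 1#                                     ≈⟨ *-congˡ (exp-inverse s-s≈0) ⟨
    exp x * exp y * (exp (x + y) * exp (- x - y))
      ≤⟨ *-monoʳ-≤ (*-nonneg (<⇒≤ (0<exp x)) (<⇒≤ (0<exp y)))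
           (*-monoʳ-≤ (<⇒≤ (0<exp _)) (exp-+-≤ (- x) (- y))) ⟩
    exp x * exp y * (exp (x + y) * (exp (- x) * exp (- y)))  ≈⟨ solve 5 (λ a b s c d →
        a :* b :* (s :* (c :* d)) := s :* (a :* c) :* (b :* d))
        refl (exp x) (exp y) _ (exp (- x)) (exp (- y)) ⟩
    exp (x + y) * (exp x * exp (- x)) * (exp y * exp (- y))
      ≈⟨ *-cong (*-congˡ (exp-inverse (-‿inverseʳ x))) (exp-inverse (-‿inverseʳ y)) ⟩
    exp (x + y) * 1# * 1#
      ≈⟨ trans (*-identityʳ _) (*-identityʳ _) ⟩
    exp (x + y)                                            ∎)
    where
    open ≤-Reasoning
    s-s≈0 : x + y + (- x - y) ≈ 0#
    s-s≈0 = solve 2 (λ x y → x :+ y :+ (:- x :- y) := con (+ 0)) refl x y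

  exp-*-fromℕ : ∀ x n → exp (x * fromℕ n) ≈ exp x ^ n
  exp-*-fromℕ x zero    = trans (exp-cong (zeroʳ x)) exp-0≈1
  exp-*-fromℕ x (suc n) = begin-equality
    exp (x * (1# + fromℕ n))
      ≈⟨ exp-cong (solve 2 (λ x n → x :* (con (+ 1) :+ n) := x :+ x :* n) refl x (fromℕ n)) ⟩
    exp (x + x * fromℕ n)      ≈⟨ exp-+ _ _ ⟩
    exp x * exp (x * fromℕ n)  ≈⟨ *-congˡ (exp-*-fromℕ x n) ⟩
    exp x * exp x ^ n          ∎
    where open ≤-Reasoning

  exp-mono-< : ∀ {x y} → x < y → exp x < exp y
  exp-mono-< {x} {y} x<y = begin-strict
    exp x                   ≈⟨ *-identityʳ _ ⟨
    exp x * 1#              <⟨ *-monoʳ-< (0<exp x) (<-by (y - x) (<⇒0<- x<y) refl) ⟩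
    exp x * (1# + (y - x))  ≤⟨ *-monoʳ-≤ (<⇒≤ (0<exp x)) (1+x≤exp (y - x)) ⟩
    exp x * exp (y - x)     ≈⟨ exp-+ x (y - x) ⟨
    exp (x + (y - x))       ≈⟨ exp-cong (solve 2 (λ x y → x :+ (y :- x) := y) refl x y) ⟩
    exp y                   ∎
    where open ≤-Reasoning

  exp-mono-≤ : ∀ {x y} → x ≤ y → exp x ≤ exp y
  exp-mono-≤ (inj₁ x<y) = inj₁ (exp-mono-< x<y)
  exp-mono-≤ (inj₂ x≈y) = inj₂ (exp-cong x≈y)

  exp-cancel-≤ : ∀ {x y} → exp x ≤ exp y → x ≤ y
  exp-cancel-≤ ex≤ey = ≮⇒≥ λ y<x → <⇒≱ (exp-mono-< y<x) ex≤ey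

  exp-injective : ∀ {x y} → exp x ≈ exp y → x ≈ y
  exp-injective ex≈ey = ≤-antisym (exp-cancel-≤ (inj₂ ex≈ey)) (exp-cancel-≤ (inj₂ (sym ex≈ey)))

  exp-shift-≥ : ∀ x h → exp x * (1# + h) ≤ exp (x + h)
  exp-shift-≥ x h = ≤-respʳ-≈ (sym (exp-+ x h)) (*-monoʳ-≤ (<⇒≤ (0<exp x)) (1+x≤exp h))

  -- Both witnesses come from 1 + y ≤ e^y: at y = 1/x it yields 1/x ≤ e^(1/x), that is e^(-1/x) ≤ x,
  -- and for any y with e^y ≤ x it yields y ≤ x - 1.
  log-lub : ∀ {x} → 0# < x → IsLeastUpperBound (λ y → exp y ≤ x) (log x)
  log-lub {x} 0<x = sup-lub (λ y → exp y ≤ x) (- (x ⁻¹) , below) (x - 1# , above)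
    where
    open ≤-Reasoning
    below : exp (- (x ⁻¹)) ≤ x
    below = *-cancelˡ-≤ (⁻¹-pos 0<x) (begin
      x ⁻¹ * exp (- (x ⁻¹))
        ≤⟨ *-monoˡ-≤ (<⇒≤ (0<exp _)) (≤-trans (≤-by 1# 0≤1 (+-comm 1# _)) (1+x≤exp (x ⁻¹))) ⟩
      exp (x ⁻¹) * exp (- (x ⁻¹))    ≈⟨ exp-inverse (-‿inverseʳ _) ⟩
      1#                             ≈⟨ pos⇒x*x⁻¹≈1 0<x ⟨
      x * x ⁻¹                       ≈⟨ *-comm _ _ ⟩
      x ⁻¹ * x                       ∎)
    above : IsUpperBound (λ y → exp y ≤ x) (x - 1#)
    above y ey≤x = begin
      y              ≈⟨ solve 1 (λ y → y := con (+ 1) :+ y :- con (+ 1)) refl y ⟩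
      1# + y - 1#    ≤⟨ +-monoˡ-≤ (- 1#) (≤-trans (1+x≤exp y) ey≤x) ⟩
      x - 1#         ∎

  -- In place of continuity, an explicit shift `h` of the supremum `L` is used: if e^L missed x,
  -- then 1 - h ≤ e^(-h) would show either that `L - h` is still an upper bound or that `L + h`
  -- still belongs to the set.
  exp-log : ∀ {x} → 0# < x → exp (log x) ≈ x
  exp-log {x} 0<x = ≤-antisym (≮⇒≥ x≮exp-L) (≮⇒≥ exp-L≮x)
    where
    open ≤-Reasoning
    L = log x
    e = exp L
    0<e = 0<exp L
    x≮exp-L : ¬ x < e
    x≮exp-L x<e = <⇒≱ (<-by h 0<h (solve 2 (λ L h → L := L :- h :+ h) refl L h))
      (proj₂ (log-lub 0<x) (L - h) λ y ey≤x → exp-cancel-≤ (begin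
        exp y            ≤⟨ ey≤x ⟩
        x                ≈⟨ solve 2 (λ e x → x := e :- (e :- x) :* con (+ 1)) refl e x ⟩
        e - (e - x) * 1#               ≈⟨ +-congˡ (-‿cong (*-congˡ (pos⇒x*x⁻¹≈1 0<e))) ⟨
        e - (e - x) * (e * e ⁻¹)       ≈⟨ solve 3 (λ e x i →
            e :- (e :- x) :* (e :* i) := e :* (con (+ 1) :- (e :- x) :* i)) refl e x (e ⁻¹) ⟩
        e * (1# - h)     ≤⟨ exp-shift-≥ L (- h) ⟩
        exp (L - h)      ∎))
      where
      -- The solution of e (1 - h) = x, so that x ≤ exp (L - h).
      h = (e - x) * e ⁻¹
      0<h = *-pos (<⇒0<- x<e) (⁻¹-pos 0<e)
    exp-L≮x : ¬ e < x
    exp-L≮x e<x = <⇒≱ (<-by h 0<h refl) (proj₁ (log-lub 0<x) (L + h) (*-cancelˡ-≤ 0<e (begin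
      e * exp (L + h)     ≈⟨ *-congʳ e≈x[1-h] ⟩
      x * (1# - h) * exp (L + h)
        ≤⟨ *-monoˡ-≤ (<⇒≤ (0<exp _)) (*-monoʳ-≤ (<⇒≤ 0<x) (1+x≤exp (- h))) ⟩
      x * exp (- h) * exp (L + h)    ≈⟨ *-assoc _ _ _ ⟩
      x * (exp (- h) * exp (L + h))  ≈⟨ *-congˡ (exp-+ _ _) ⟨
      x * exp (- h + (L + h))
        ≈⟨ *-congˡ (exp-cong (solve 2 (λ L h → :- h :+ (L :+ h) := L) refl L h)) ⟩
      x * e                          ≈⟨ *-comm _ _ ⟩
      e * x                          ∎)))
      where
      -- The solution of x (1 - h) = e, so that exp (L + h) ≤ x.
      h = (x - e) * x ⁻¹
      0<h = *-pos (<⇒0<- e<x) (⁻¹-pos 0<x)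
      e≈x[1-h] : e ≈ x * (1# - h)
      e≈x[1-h] = begin-equality
        e                          ≈⟨ solve 2 (λ e x → e := x :- (x :- e) :* con (+ 1)) refl e x ⟩
        x - (x - e) * 1#           ≈⟨ +-congˡ (-‿cong (*-congˡ (pos⇒x*x⁻¹≈1 0<x))) ⟨
        x - (x - e) * (x * x ⁻¹)   ≈⟨ solve 3 (λ e x i →
            x :- (x :- e) :* (x :* i) := x :* (con (+ 1) :- (x :- e) :* i)) refl e x (x ⁻¹) ⟩
        x * (1# - h)               ∎

  log-unique : ∀ {x y} → exp y ≈ x → log x ≈ y
  log-unique {x} {y} ey≈x =
    exp-injective (trans (exp-log (<-respʳ-≈ ey≈x (0<exp y))) (sym ey≈x))

  log-cong : ∀ {x y} → 0# < y → x ≈ y → log x ≈ log y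
  log-cong 0<y x≈y = log-unique (trans (exp-log 0<y) (sym x≈y))

  log-* : ∀ {x y} → 0# < x → 0# < y → log (x * y) ≈ log x + log y
  log-* 0<x 0<y = log-unique (trans (exp-+ _ _) (*-cong (exp-log 0<x) (exp-log 0<y)))

-- Density of the rationals; half-lines and points as Borel sets

module BorelSets ⦃ ℝ : Reals ⦄ where
  open OrderedField ℝ
  open Completeness ℝ

  arbitrarily-small : ∀ {d} → 0# < d → ¬ ¬ ∃ λ n → fromℕ (suc n) ⁻¹ < d
  arbitrarily-small {d} 0<d k = Eventually⇒¬¬∃ (eventually-large (d ⁻¹)) λ (n , d⁻¹<n) →
    let 0<n = fromℕ-suc-pos n
        N   = fromℕ (suc n)
    in k (n , *-cancelˡ-< (*-pos 0<n (⁻¹-pos 0<d)) (begin-strict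
      N * d ⁻¹ * N ⁻¹
        ≈⟨ solve 3 (λ N i j → N :* i :* j := i :* (N :* j)) refl N (d ⁻¹) (N ⁻¹) ⟩
      d ⁻¹ * (N * N ⁻¹)    ≈⟨ *-congˡ (pos⇒x*x⁻¹≈1 0<n) ⟩
      d ⁻¹ * 1#            ≈⟨ *-identityʳ _ ⟩
      d ⁻¹                 <⟨ d⁻¹<n ⟩
      N                    ≈⟨ *-identityʳ _ ⟨
      N * 1#               ≈⟨ *-congˡ (pos⇒x*x⁻¹≈1 0<d) ⟨
      N * (d * d ⁻¹)       ≈⟨ solve 3 (λ N d i → N :* (d :* i) := N :* i :* d) refl N d (d ⁻¹) ⟩
      N * d ⁻¹ * d         ∎))
    where open ≤-Reasoning

  -- Every rational is a difference of naturals over a positive natural. With three natural indices,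
  -- a union over the rationals is three nested countable unions.
  fraction : ℕ → ℕ → ℕ → Carrier
  fraction m k l = (fromℕ k - fromℕ l) / fromℕ (suc m)

  -- Fix a step 1/(m + 1) shorter than the gap and an l for which the fraction with k = 0 is at most
  -- x. If no fraction fell into the gap, increasing k by one could never cross it, so every k would
  -- give a fraction at most x and the naturals would be bounded.
  fractions-dense : ∀ {x y} → x < y →
                    ¬ ¬ ∃ λ m → ∃ λ k → ∃ λ l → x < fraction m k l × fraction m k l < y
  fractions-dense {x} {y} x<y none = arbitrarily-small (<⇒0<- x<y) λ (m , ι<y-x) →
    Eventually⇒¬¬∃ (eventually-large (- (x * fromℕ (suc m)))) λ (l , -xM<l) →
      unbounded m (suc l) (<⇒≤ -xM<l) ι<y-x
    where
    open ≤-Reasoning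
    unbounded : ∀ m l → - (x * fromℕ (suc m)) ≤ fromℕ l → ¬ fromℕ (suc m) ⁻¹ < y - x
    unbounded m l -xM≤l ι<y-x = archimedean (x * M + fromℕ l) λ k → begin
      fromℕ k
        ≈⟨ solve 2 (λ k l → k := k :- l :+ l) refl (fromℕ k) (fromℕ l) ⟩
      fromℕ k - fromℕ l + fromℕ l      ≈⟨ +-congʳ (M*q≈k-l k) ⟨
      M * q k + fromℕ l                ≤⟨ +-monoˡ-≤ _ (*-monoʳ-≤ (<⇒≤ 0<M) (q≤x k)) ⟩
      M * x + fromℕ l                  ≈⟨ +-congʳ (*-comm M x) ⟩
      x * M + fromℕ l                  ∎
      where
      M   = fromℕ (suc m)
      ι   = M ⁻¹
      0<M = fromℕ-suc-pos m
      q : ℕ → Carrier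
      q k = fraction m k l
      M*q≈k-l : ∀ k → M * q k ≈ fromℕ k - fromℕ l
      M*q≈k-l k = begin-equality
        M * ((fromℕ k - fromℕ l) * ι)
          ≈⟨ solve 3 (λ M a i → M :* (a :* i) := M :* i :* a) refl M _ ι ⟩
        M * ι * (fromℕ k - fromℕ l)    ≈⟨ *-congʳ (pos⇒x*x⁻¹≈1 0<M) ⟩
        1# * (fromℕ k - fromℕ l)       ≈⟨ *-identityˡ _ ⟩
        fromℕ k - fromℕ l              ∎
      q≤x : ∀ k → q k ≤ x
      q≤x zero    = *-cancelˡ-≤ 0<M (begin
        M * q zero        ≈⟨ M*q≈k-l zero ⟩
        0# - fromℕ l      ≈⟨ +-identityˡ _ ⟩
        - fromℕ l         ≤⟨ neg-mono-≤ -xM≤l ⟩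
        - - (x * M)       ≈⟨ solve 2 (λ x M → :- :- (x :* M) := M :* x) refl x M ⟩
        M * x             ∎)
      q≤x (suc k) = ≮⇒≥ λ x<q → none (m , suc k , l , x<q , (begin-strict
        q (suc k)      ≈⟨ solve 3 (λ k l i → (con (+ 1) :+ k :- l) :* i := (k :- l) :* i :+ i)
                            refl (fromℕ k) (fromℕ l) ι ⟩
        q k + ι        ≤⟨ +-monoˡ-≤ ι (q≤x k) ⟩
        x + ι          <⟨ +-monoʳ-< x ι<y-x ⟩
        x + (y - x)    ≈⟨ solve 2 (λ x y → x :+ (y :- x) := y) refl x y ⟩
        y              ∎))

  -- Since Archimedes holds only up to double negation, a half-line [a , ∞) is
  -- written as the complement of a union.
  Borel-≥ : ∀ a → Borel (a ≤_)
  Borel-≥ a = resp-≐ (above , below) (complement (union λ n → half-line (a - fromℕ (suc n) ⁻¹)))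
    where
    above : ∀ {x} → ¬ (∃ λ n → x ≤ a - fromℕ (suc n) ⁻¹) → a ≤ x
    above {x} ∄n = ≮⇒≥ λ x<a → arbitrarily-small (<⇒0<- x<a) λ (n , ι<a-x) →
      ∄n (n , ≤-by (a - x - fromℕ (suc n) ⁻¹) (<⇒≤ (<⇒0<- ι<a-x))
        (solve 3 (λ a x i → a :- i := x :+ (a :- x :- i)) refl a x _))
    below : ∀ {x} → a ≤ x → ¬ (∃ λ n → x ≤ a - fromℕ (suc n) ⁻¹)
    below {x} a≤x (n , x≤a-ι) = <⇒≱
      (<-by (fromℕ (suc n) ⁻¹) (⁻¹-pos (fromℕ-suc-pos n))
        (solve 2 (λ a i → a := a :- i :+ i) refl a _))
      (≤-trans a≤x x≤a-ι)

  Borel-≈ : ∀ a → Borel (_≈ a)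
  Borel-≈ a = resp-≐ (to , from) (complement (union sides))
    where
    side : ℕ → Pred Carrier 0ℓ
    side zero    = ∁ (_≤ a)
    side (suc _) = ∁ (a ≤_)
    sides : ∀ n → Borel (side n)
    sides zero    = complement (half-line a)
    sides (suc _) = complement (Borel-≥ a)
    to : ∀ {x} → ¬ (∃ λ n → side n x) → x ≈ a
    to ∄n = ≤-antisym (≤-stable λ x≰a → ∄n (0 , x≰a)) (≤-stable λ a≰x → ∄n (1 , a≰x))
    from : ∀ {x} → x ≈ a → ¬ (∃ λ n → side n x)
    from x≈a (zero  , x≰a) = x≰a (inj₂ x≈a)
    from x≈a (suc _ , a≰x) = a≰x (inj₂ (sym x≈a))

-- Finite additivity, monotonicity and sums of random variables

module Probability ⦃ ℝ : Reals ⦄ ⦃ 𝒫 : ProbabilitySpace ⦄ where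
  open OrderedField ℝ
  open BorelSets
  open ProbabilitySpace 𝒫

  -- Decidability recovers A ∩ B from the complement of ∁ A ∪ ∁ B, and lets an event be split into
  -- its parts inside and outside another.
  DecEvent : Pred Ω 0ℓ → Set₁
  DecEvent A = Event A × Decidable A

  Event-∅ : Event ∅
  Event-∅ = Event-resp-≐ ((λ ¬⊤ → ¬⊤ tt) , λ ()) (Event-∁ Event-U)

  DecEvent-∅ : DecEvent ∅
  DecEvent-∅ = Event-∅ , λ _ → no λ ()

  DecEvent-∁ : ∀ {A} → DecEvent A → DecEvent (∁ A)
  DecEvent-∁ (A-ev , A?) = Event-∁ A-ev , λ ω → ¬? (A? ω)

  -- Padding with `∅` keeps the family pairwise disjoint, so that countable additivity applies to
  -- two events.
  pair : Pred Ω 0ℓ → Pred Ω 0ℓ → ℕ → Pred Ω 0ℓ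
  pair A B zero          = A
  pair A B (suc zero)    = B
  pair A B (suc (suc _)) = ∅

  Event-pair : ∀ {A B} → Event A → Event B → ∀ i → Event (pair A B i)
  Event-pair A-ev B-ev zero          = A-ev
  Event-pair A-ev B-ev (suc zero)    = B-ev
  Event-pair A-ev B-ev (suc (suc _)) = Event-∅

  ⋃-pair≐∪ : ∀ {A B} → (λ ω → ∃ λ i → pair A B i ω) ≐ A ∪ B
  ⋃-pair≐∪ =
    (λ { (zero , a) → inj₁ a ; (suc zero , b) → inj₂ b ; (suc (suc _) , ()) }) ,
    (λ { (inj₁ a) → 0 , a ; (inj₂ b) → 1 , b })

  Event-∪ : ∀ {A B} → Event A → Event B → Event (A ∪ B)
  Event-∪ A-ev B-ev = Event-resp-≐ ⋃-pair≐∪ (Event-⋃ (Event-pair A-ev B-ev))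

  DecEvent-∩ : ∀ {A B} → DecEvent A → DecEvent B → DecEvent (A ∩ B)
  DecEvent-∩ {A} {B} (A-ev , A?) (B-ev , B?) =
    Event-resp-≐
      ( (λ {ω} ¬∁ → decidable-stable (A? ω) (¬∁ ∘ inj₁) , decidable-stable (B? ω) (¬∁ ∘ inj₂))
      , λ { (a , b) → [ (λ ¬a → ¬a a) , (λ ¬b → ¬b b) ] })
      (Event-∁ (Event-∪ (Event-∁ A-ev) (Event-∁ B-ev))) ,
    λ ω → A? ω ×-dec B? ω

  DecEvent-∀ : ∀ {n} {A : Fin n → Pred Ω 0ℓ} → (∀ i → DecEvent (A i)) →
               DecEvent (λ ω → ∀ i → A i ω)
  DecEvent-∀ {n} A-dec = event A-dec , λ ω → Fin.all? λ i → proj₂ (A-dec i) ω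
    where
    event : ∀ {n} {A : Fin n → Pred Ω 0ℓ} → (∀ i → DecEvent (A i)) → Event (λ ω → ∀ i → A i ω)
    event {zero}  A-dec = Event-resp-≐ ((λ _ ()) , λ _ → tt) Event-U
    event {suc n} A-dec = Event-resp-≐
      ((λ { (a , as) zero → a ; (a , as) (suc i) → as i }) , λ as → as zero , as ∘ suc)
      (proj₁ (DecEvent-∩ (A-dec zero) (DecEvent-∀ (A-dec ∘ suc))))

  eventually-constant-limit : ∀ {u : ℕ → Carrier} {c l} N →
                              (∀ n → N ℕ.≤ n → u n ≈ c) → u ⟶ l → l ≈ c
  eventually-constant-limit {u} {c} {l} N u≈c u⟶l with compare l c
  ... | tri≈ _ l≈c _ = l≈c
  ... | tri< l<c _ _ = contradiction (begin-strict
          c            ≈⟨ u≈c n (ℕ.m≤m⊔n N _) ⟨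
          u n          <⟨ proj₂ (proj₂ lim n (ℕ.m≤n⊔m N _)) ⟩
          l + (c - l)  ≈⟨ solve 2 (λ l c → l :+ (c :- l) := c) refl l c ⟩
          c            ∎) (<-irrefl refl)
    where
    open ≤-Reasoning
    lim = u⟶l (c - l) (<⇒0<- l<c)
    n   = N ℕ.⊔ proj₁ lim
  ... | tri> _ _ c<l = contradiction (begin-strict
          c            ≈⟨ solve 2 (λ l c → c := l :- (l :- c)) refl l c ⟩
          l - (l - c)  <⟨ proj₁ (proj₂ lim n (ℕ.m≤n⊔m N _)) ⟩
          u n          ≈⟨ u≈c n (ℕ.m≤m⊔n N _) ⟩
          c            ∎) (<-irrefl refl)
    where
    open ≤-Reasoning
    lim = u⟶l (l - c) (<⇒0<- c<l)
    n   = N ℕ.⊔ proj₁ lim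

  -- Countably many copies of `∅` are disjoint with union `∅`. If P ∅ were positive, then with ε = P
  -- ∅ the partial sum of N + 2 terms would be less than 2 P ∅, which its first two terms already
  -- reach.
  P-∅ : P ∅ ≈ 0#
  P-∅ = ≤-antisym (≮⇒≥ 0≮P∅) (P-nonneg Event-∅)
    where
    open ≤-Reasoning
    sum-nonneg : ∀ n → 0# ≤ sum {n} (λ _ → P ∅)
    sum-nonneg zero    = ≤-refl
    sum-nonneg (suc n) = +-nonneg (P-nonneg Event-∅) (sum-nonneg n)
    0≮P∅ : ¬ 0# < P ∅
    0≮P∅ 0<P∅ = <-irrefl refl (begin-strict
      P ∅ + P ∅                      ≈⟨ +-congˡ (+-identityʳ _) ⟨
      P ∅ + (P ∅ + 0#)               ≤⟨ +-monoʳ-≤ _ (+-monoʳ-≤ _ (sum-nonneg N)) ⟩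
      P ∅ + (P ∅ + sum {N} (λ _ → P ∅))  <⟨ proj₂ (proj₂ lim (suc (suc N)) (ℕ.m≤n+m N 2)) ⟩
      P (λ ω → ∃ λ (i : ℕ) → ω ∈ ∅) + P ∅   ≈⟨ +-congʳ (P-cong Event-∅ ((λ ()) , λ ())) ⟨
      P ∅ + P ∅                      ∎)
      where
      lim = P-⋃ {λ _ → ∅} (λ _ → Event-∅) (λ _ ()) (P ∅) 0<P∅
      N   = proj₁ lim

  P-∪ : ∀ {A B} → Event A → Event B → A ⊥ B → P (A ∪ B) ≈ P A + P B
  P-∪ {A} {B} A-ev B-ev A⊥B = trans
    (sym (P-cong (Event-⋃ (Event-pair A-ev B-ev)) ⋃-pair≐∪))
    (eventually-constant-limit 2 partial (P-⋃ (Event-pair A-ev B-ev) disjoint))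
    where
    open Sum +-monoid using (sum-cong-≋; sum-replicate-zero)
    partial : ∀ n → 2 ℕ.≤ n → sum {n} (λ i → P (pair A B (toℕ i))) ≈ P A + P B
    partial (suc (suc n)) _ = +-congˡ (trans (+-congˡ
      (trans (sum-cong-≋ {n} (λ _ → P-∅)) (sum-replicate-zero n))) (+-identityʳ _))
    partial (suc zero) (ℕ.s≤s ())
    disjoint : ∀ {i j} → i ≢ j → pair A B i ⊥ pair A B j
    disjoint {zero}        {zero}        i≢j _       = i≢j ≡.refl
    disjoint {zero}        {suc zero}    _   ab      = A⊥B ab
    disjoint {zero}        {suc (suc _)} _   (_ , ())
    disjoint {suc zero}    {zero}        _   (b , a) = A⊥B (a , b)
    disjoint {suc zero}    {suc zero}    i≢j _       = i≢j ≡.refl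
    disjoint {suc zero}    {suc (suc _)} _   (_ , ())
    disjoint {suc (suc _)}               _   (() , _)

  P-split : ∀ {A B} → DecEvent A → DecEvent B → P A ≈ P (A ∩ B) + P (A ∩ ∁ B)
  P-split {A} {B} A-dec B-dec@(_ , B?) = trans
    (P-cong (proj₁ A-dec) (split , [ proj₁ , proj₁ ]))
    (P-∪ (proj₁ (DecEvent-∩ A-dec B-dec)) (proj₁ (DecEvent-∩ A-dec (DecEvent-∁ B-dec)))
      λ { ((_ , b) , (_ , ¬b)) → ¬b b })
    where
    split : A ⊆ (A ∩ B) ∪ (A ∩ ∁ B)
    split {ω} a with B? ω
    ... | yes b = inj₁ (a , b)
    ... | no ¬b = inj₂ (a , ¬b)

  P-mono : ∀ {A B} → DecEvent A → DecEvent B → A ⊆ B → P A ≤ P B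
  P-mono {A} {B} A-dec B-dec A⊆B = ≤-by (P (B ∩ ∁ A))
    (P-nonneg (proj₁ (DecEvent-∩ B-dec (DecEvent-∁ A-dec))))
    (trans (P-split B-dec A-dec) (+-congʳ (P-cong (proj₁ (DecEvent-∩ B-dec A-dec))
      (proj₂ , λ a → A⊆B a , a))))

  -- `A` and `B` may leave part of Ω uncovered, but as their probabilities add up to 1 the remainder
  -- is null. In this way the values of a Bernoulli variable other than 0 and 1 are discarded.
  P-≤-partition : ∀ {A B C} → DecEvent A → DecEvent B → DecEvent C → A ⊥ B → P A + P B ≈ 1# →
                  P C ≤ P (C ∩ A) + P (C ∩ B)
  P-≤-partition {A} {B} {C} A-dec B-dec C-dec A⊥B PA+PB≈1 = begin
    P C                          ≈⟨ P-split C-dec A-dec ⟩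
    P (C ∩ A) + P (C ∩ ∁ A)      ≈⟨ +-congˡ (P-split C∖A-dec B-dec) ⟩
    P (C ∩ A) + (P ((C ∩ ∁ A) ∩ B) + P ((C ∩ ∁ A) ∩ ∁ B))
      ≤⟨ +-monoʳ-≤ _ (+-mono-≤
           (P-mono (DecEvent-∩ C∖A-dec B-dec) (DecEvent-∩ C-dec B-dec) λ ((c , _) , b) → c , b)
           (P-mono (DecEvent-∩ C∖A-dec (DecEvent-∁ B-dec)) N-dec λ ((_ , ¬a) , ¬b) → ¬a , ¬b)) ⟩
    P (C ∩ A) + (P (C ∩ B) + P N)  ≈⟨ +-congˡ (trans (+-congˡ PN≈0) (+-identityʳ _)) ⟩
    P (C ∩ A) + P (C ∩ B)        ∎
    where
    open ≤-Reasoning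
    N = ∁ A ∩ ∁ B
    N-dec : DecEvent N
    N-dec = DecEvent-∩ (DecEvent-∁ A-dec) (DecEvent-∁ B-dec)
    C∖A-dec = DecEvent-∩ C-dec (DecEvent-∁ A-dec)
    PN≈0 : P N ≈ 0#
    PN≈0 = begin-equality
      P N
        ≈⟨ solve 2 (λ n s → n := s :+ n :- s) refl (P N) (P A + P B) ⟩
      P A + P B + P N - (P A + P B)          ≈⟨ +-cong (trans total (sym PA+PB≈1)) refl ⟩
      P A + P B - (P A + P B)                ≈⟨ -‿inverseʳ _ ⟩
      0#                                     ∎
      where
      total : P A + P B + P N ≈ 1#
      total = begin-equality
        P A + P B + P N         ≈⟨ +-assoc _ _ _ ⟩
        P A + (P B + P N)
          ≈⟨ +-congˡ (+-congʳ (P-cong (proj₁ B-dec) ((λ b → (λ a → A⊥B (a , b)) , b) , proj₂))) ⟩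
        P A + (P (∁ A ∩ B) + P N)  ≈⟨ +-congˡ (P-split (DecEvent-∁ A-dec) B-dec) ⟨
        P A + P (∁ A)
          ≈⟨ P-∪ (proj₁ A-dec) (proj₁ (DecEvent-∁ A-dec)) (λ (a , ¬a) → ¬a a) ⟨
        P (A ∪ ∁ A)
          ≈⟨ P-cong (Event-∪ (proj₁ A-dec) (proj₁ (DecEvent-∁ A-dec)))
            ((λ _ → tt) , λ {ω} _ → excl ω) ⟩
        P U                     ≈⟨ P-U ⟩
        1#                      ∎
        where
        excl : ∀ ω → (A ∪ ∁ A) ω
        excl ω with proj₂ A-dec ω
        ... | yes a = inj₁ a
        ... | no ¬a = inj₂ ¬a

  isRandomVariable : ∀ {f : Ω → Carrier} → (∀ a → Event (λ ω → f ω ≤ a)) → IsRandomVariable f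
  isRandomVariable f≤ (half-line a)          = f≤ a
  isRandomVariable f≤ (complement B-borel)   = Event-∁ (isRandomVariable f≤ B-borel)
  isRandomVariable f≤ (union B-borel)        = Event-⋃ λ i → isRandomVariable f≤ (B-borel i)
  isRandomVariable f≤ (resp-≐ (B⊆C , C⊆B) B-borel) =
    Event-resp-≐ (B⊆C , C⊆B) (isRandomVariable f≤ B-borel)

  -- {f + g > a} is the union of the {f > q} ∩ {g > a - q} over all fractions q.
  isRandomVariable-+ : ∀ {f g : Ω → Carrier} → IsRandomVariable f → IsRandomVariable g →
                       IsRandomVariable (λ ω → f ω + g ω)
  isRandomVariable-+ {f} {g} f-rv g-rv = isRandomVariable λ a →
    Event-resp-≐ (below a , above a)
      (Event-∁ (Event-⋃ λ m → Event-⋃ λ k → Event-⋃ λ l → Both-event a (fraction m k l)))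
    where
    Both : Carrier → Carrier → Pred Ω 0ℓ
    Both a q = (λ ω → ¬ f ω ≤ q) ∩ (λ ω → ¬ g ω ≤ a - q)
    Both-event : ∀ a q → Event (Both a q)
    Both-event a q = proj₁ (DecEvent-∩
      (DecEvent-∁ (f-rv (half-line q) , λ ω → f ω ≤? q))
      (DecEvent-∁ (g-rv (half-line (a - q)) , λ ω → g ω ≤? a - q)))
    below : ∀ a {ω} → ¬ (∃ λ m → ∃ λ k → ∃ λ l → Both a (fraction m k l) ω) → f ω + g ω ≤ a
    below a {ω} none = ≮⇒≥ λ a<f+g → fractions-dense
      (<-by {a - g ω} {f ω} (f ω + g ω - a) (<⇒0<- a<f+g)
        (solve 3 (λ a f g → f := a :- g :+ (f :+ g :- a)) refl a (f ω) (g ω)))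
      λ (m , k , l , a-g<q , q<f) → none (m , k , l , <⇒≱ q<f ,
        <⇒≱ (<-by _ (<⇒0<- a-g<q)
          (solve 3 (λ a q g → g := a :- q :+ (q :- (a :- g))) refl a (fraction m k l) (g ω))))
    above : ∀ a {ω} → f ω + g ω ≤ a → ¬ (∃ λ m → ∃ λ k → ∃ λ l → Both a (fraction m k l) ω)
    above a {ω} f+g≤a (m , k , l , f≰q , g≰a-q) = g≰a-q (≤-by
      (f ω - fraction m k l + (a - (f ω + g ω)))
      (+-nonneg (<⇒≤ (<⇒0<- (≰⇒> f≰q))) (≤⇒0≤- f+g≤a))
      (solve 4 (λ a q f g → a :- q := g :+ (f :- q :+ (a :- (f :+ g))))
        refl a (fraction m k l) (f ω) (g ω)))

  isRandomVariable-sum : ∀ {n} {X : Fin n → Ω → Carrier} → (∀ i → IsRandomVariable (X i)) →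
                         IsRandomVariable (λ ω → sum (λ i → X i ω))
  isRandomVariable-sum {zero}  X-rv = isRandomVariable constant
    where
    constant : ∀ a → Event (λ ω → 0# ≤ a)
    constant a with 0# ≤? a
    ... | yes 0≤a = Event-resp-≐ ((λ _ → 0≤a) , λ _ → tt) Event-U
    ... | no  0≰a = Event-resp-≐ ((λ ()) , 0≰a) Event-∅
  isRandomVariable-sum {suc n} X-rv =
    isRandomVariable-+ (X-rv zero) (isRandomVariable-sum (X-rv ∘ suc))

-- The exponential tail bound, atom by atom

module Chernoff ⦃ ℝ : Reals ⦄ ⦃ 𝒫 : ProbabilitySpace ⦄ where
  open OrderedField ℝ
  open Exponential using (0<exp; 1+x≤exp)
  open ExpLog
  open BorelSets
  open Probability
  open ProbabilitySpace 𝒫 using (Ω; P; P-cong)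
  open Exp commutativeSemiring using (^-congˡ)

  bit : Bool → Carrier
  bit true  = 1#
  bit false = 0#

  -- By distributivity, the products of weights over all b in {0,1}ⁿ add up to (w true + w false)ⁿ.
  -- The induction splits on the first variable, absorbing its value into `C` and its weight into
  -- `K`, so no sum over atoms is ever written.
  P-≤-by-atoms : ∀ {n} {X : Fin n → Ω → Carrier} →
    (∀ i b → DecEvent (λ ω → X i ω ≈ bit b)) →
    (∀ i → P (λ ω → X i ω ≈ 1#) + P (λ ω → X i ω ≈ 0#) ≈ 1#) →
    (w : Bool → Carrier) → ∀ {C K} → DecEvent C →
    (∀ (b : Fin n → Bool) → P (C ∩ λ ω → ∀ i → X i ω ≈ bit (b i)) ≤ K * product (w ∘ b)) →
    P C ≤ K * (w true + w false) ^ n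
  P-≤-by-atoms {zero} X-dec X-bit w C-dec atom≤ =
    ≤-respˡ-≈ (P-cong (proj₁ (DecEvent-∩ C-dec (DecEvent-∀ λ ()))) (proj₁ , λ c → c , λ ()))
      (atom≤ λ ())
  P-≤-by-atoms {suc n} {X} X-dec X-bit w {C} {K} C-dec atom≤ = begin
    P C
      ≤⟨ P-≤-partition (X-dec zero true) (X-dec zero false) C-dec
           (λ (X≈1 , X≈0) → 0≉1 (trans (sym X≈0) X≈1)) (X-bit zero) ⟩
    P (C ∩ (λ ω → X zero ω ≈ 1#)) + P (C ∩ (λ ω → X zero ω ≈ 0#))
      ≤⟨ +-mono-≤ (branch true) (branch false) ⟩
    K * w true * W ^ n + K * w false * W ^ n   ≈⟨ solve 4 (λ K t f p →
        K :* t :* p :+ K :* f :* p := K :* ((t :+ f) :* p)) refl K (w true) (w false) (W ^ n) ⟩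
    K * (W * W ^ n)                      ∎
    where
    open ≤-Reasoning
    W = w true + w false
    branch : ∀ c → P (C ∩ (λ ω → X zero ω ≈ bit c)) ≤ K * w c * W ^ n
    branch c = P-≤-by-atoms (X-dec ∘ suc) (X-bit ∘ suc) w C∩-dec λ b → begin
      P ((C ∩ (λ ω → X zero ω ≈ bit c)) ∩ (λ ω → ∀ i → X (suc i) ω ≈ bit (b i)))
        ≈⟨ P-cong (proj₁ (DecEvent-∩ C∩-dec (DecEvent-∀ λ i → X-dec (suc i) (b i))))
             ( (λ ((cω , x) , xs) → cω , λ { zero → x ; (suc i) → xs i })
             , (λ (cω , xs) → (cω , xs zero) , xs ∘ suc)) ⟩
      P (C ∩ (λ ω → ∀ i → X i ω ≈ bit ((c ∷ b) i)))   ≤⟨ atom≤ (c ∷ b) ⟩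
      K * (w c * product (w ∘ b))                      ≈⟨ *-assoc _ _ _ ⟨
      K * w c * product (w ∘ b)                        ∎
      where C∩-dec = DecEvent-∩ C-dec (X-dec zero c)

  product-nonneg : ∀ {n} {f : Fin n → Carrier} → (∀ i → 0# ≤ f i) → 0# ≤ product f
  product-nonneg {zero}  0≤f = 0≤1
  product-nonneg {suc n} 0≤f = *-nonneg (0≤f zero) (product-nonneg (0≤f ∘ suc))

  product-exp : ∀ {n} (q x : Fin n → Carrier) l →
                product (λ i → q i * exp (l * x i)) ≈ product q * exp (l * sum x)
  product-exp {zero} q x l = begin-equality
    1#                 ≈⟨ *-identityʳ _ ⟨
    1# * 1#            ≈⟨ *-congˡ (trans (exp-cong (zeroʳ l)) exp-0≈1) ⟨
    1# * exp (l * 0#)  ∎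
    where open ≤-Reasoning
  product-exp {suc n} q x l = begin-equality
    q zero * exp (l * x zero) * product (λ i → q (suc i) * exp (l * x (suc i)))
      ≈⟨ *-congˡ (product-exp (q ∘ suc) (x ∘ suc) l) ⟩
    q zero * exp (l * x zero) * (product (q ∘ suc) * exp (l * sum (x ∘ suc)))
      ≈⟨ solve 4 (λ a b c d → a :* b :* (c :* d) := a :* c :* (b :* d)) refl _ _ _ _ ⟩
    product q * (exp (l * x zero) * exp (l * sum (x ∘ suc)))
      ≈⟨ *-congˡ (exp-+ _ _) ⟨
    product q * exp (l * x zero + l * sum (x ∘ suc))
      ≈⟨ *-congˡ (exp-cong (distribˡ l _ _)) ⟨
    product q * exp (l * sum x)  ∎
    where open ≤-Reasoning

  module _ {n} {p : Carrier} (0<p : 0# < p) (p<1 : p < 1#) {X : Fin n → Ω → Carrier}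
           (X-rv : ∀ i → IsRandomVariable (X i)) (X-indep : Independent X)
           (X∼b : ∀ i → X i ∼b p) where
    open ≤-Reasoning

    S : Ω → Carrier
    S ω = sum (λ i → X i ω)

    DecEvent-S≥ : ∀ a → DecEvent (λ ω → S ω ≥ a)
    DecEvent-S≥ a = isRandomVariable-sum X-rv (Borel-≥ a) , λ ω → a ≤? S ω

    weight : Bool → Carrier
    weight true  = p
    weight false = 1# - p

    0≤weight : ∀ b → 0# ≤ weight b
    0≤weight true  = <⇒≤ 0<p
    0≤weight false = <⇒≤ (<⇒0<- p<1)

    P-atom : ∀ b → P (λ ω → ∀ i → X i ω ≈ bit (b i)) ≈ product (weight ∘ b)
    P-atom b = trans (X-indep (λ i → _≈ bit (b i)) (λ i → Borel-≈ (bit (b i))))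
      (sum-cong-≋ {n} λ i → marginal i (b i))
      where
      open Sum *-monoid using (sum-cong-≋)
      marginal : ∀ i b → P (λ ω → X i ω ≈ bit b) ≈ weight b
      marginal i true  = proj₁ (X∼b i)
      marginal i false = proj₂ (X∼b i)

    -- Markov's inequality on each atom: there S is the constant v, the sum of the bits, so {S ≥ a}
    -- meets the atom in all of it or in nothing. Since l ≥ 0, the factor e^(l(v - a)) is at least 1
    -- in the first case, and it is positive in the second.
    tail-≤ : ∀ {l} → 0# ≤ l → ∀ a →
             P (λ ω → S ω ≥ a) ≤ exp (- (l * a)) * (p * exp l + (1# - p)) ^ n
    tail-≤ {l} 0≤l a = begin
      P (λ ω → S ω ≥ a)
        ≤⟨ P-≤-by-atoms X-dec total tilted (DecEvent-S≥ a) atom≤ ⟩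
      K * (tilted true + tilted false) ^ n       ≈⟨ *-congˡ (^-congˡ n (+-cong
          (*-congˡ (exp-cong (*-identityʳ l)))
          (trans (*-congˡ (trans (exp-cong (zeroʳ l)) exp-0≈1)) (*-identityʳ _)))) ⟩
      K * (p * exp l + (1# - p)) ^ n             ∎
      where
      K = exp (- (l * a))
      tilted : Bool → Carrier
      tilted b = weight b * exp (l * bit b)
      X-dec : ∀ i b → DecEvent (λ ω → X i ω ≈ bit b)
      X-dec i b = X-rv i (Borel-≈ (bit b)) , λ ω → X i ω ≟ bit b
      total : ∀ i → P (λ ω → X i ω ≈ 1#) + P (λ ω → X i ω ≈ 0#) ≈ 1#
      total i = trans (+-cong (proj₁ (X∼b i)) (proj₂ (X∼b i)))
        (solve 1 (λ p → p :+ (con (+ 1) :- p) := con (+ 1)) refl p)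
      atom≤ : ∀ b → P ((λ ω → S ω ≥ a) ∩ (λ ω → ∀ i → X i ω ≈ bit (b i))) ≤ K * product (tilted ∘ b)
      atom≤ b = ≤-respʳ-≈ (sym K*product) bound
        where
        v = sum (bit ∘ b)
        Π = product (weight ∘ b)
        0≤Π = product-nonneg (0≤weight ∘ b)
        Atom-dec = DecEvent-∀ λ i → X-dec i (b i)
        S≥∩Atom-dec = DecEvent-∩ (DecEvent-S≥ a) Atom-dec
        K*product : K * product (tilted ∘ b) ≈ Π * exp (l * (v - a))
        K*product = begin-equality
          K * product (tilted ∘ b)       ≈⟨ *-congˡ (product-exp (weight ∘ b) (bit ∘ b) l) ⟩
          K * (Π * exp (l * v))
            ≈⟨ solve 3 (λ k q e → k :* (q :* e) := q :* (e :* k)) refl _ _ _ ⟩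
          Π * (exp (l * v) * K)          ≈⟨ *-congˡ (exp-+ _ _) ⟨
          Π * exp (l * v - l * a)        ≈⟨ *-congˡ (exp-cong (solve 3 (λ l v a →
              l :* v :- l :* a := l :* (v :- a)) refl l v a)) ⟩
          Π * exp (l * (v - a))          ∎
        bound : P ((λ ω → S ω ≥ a) ∩ (λ ω → ∀ i → X i ω ≈ bit (b i))) ≤ Π * exp (l * (v - a))
        bound with a ≤? v
        ... | yes a≤v = begin
          P ((λ ω → S ω ≥ a) ∩ (λ ω → ∀ i → X i ω ≈ bit (b i)))
            ≤⟨ P-mono S≥∩Atom-dec Atom-dec proj₂ ⟩
          P (λ ω → ∀ i → X i ω ≈ bit (b i))                       ≈⟨ P-atom b ⟩
          Π                                                        ≈⟨ *-identityʳ _ ⟨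
          Π * 1#                                                   ≈⟨ *-congˡ exp-0≈1 ⟨
          Π * exp 0#                ≤⟨ *-monoʳ-≤ 0≤Π (exp-mono-≤ (*-nonneg 0≤l (≤⇒0≤- a≤v))) ⟩
          Π * exp (l * (v - a))     ∎
        ... | no a≰v = begin
          P ((λ ω → S ω ≥ a) ∩ (λ ω → ∀ i → X i ω ≈ bit (b i)))
            ≤⟨ P-mono S≥∩Atom-dec DecEvent-∅
                 (λ (a≤S , X≈b) → a≰v (≤-respʳ-≈ (sum-cong-≋ {n} X≈b) a≤S)) ⟩
          P ∅                       ≈⟨ P-∅ ⟩
          0#                        ≤⟨ *-nonneg 0≤Π (<⇒≤ (0<exp _)) ⟩
          Π * exp (l * (v - a))     ∎
          where open Sum +-monoid using (sum-cong-≋)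

-- The closed forms of the bound

module BoundIdentities ⦃ ℝ : Reals ⦄ where
  open OrderedField ℝ
  open Exponential using (0<exp; 1+x≤exp)
  open ExpLog
  open ≤-Reasoning
  open Exp commutativeSemiring using (^-congˡ)

  -- No congruence is assumed of `_⁻¹`, so the reciprocal of `v` is identified with `exp (- y)`
  -- through uniqueness of inverses.
  /-exp : ∀ {u v x y} → u ≈ exp x → v ≈ exp y → u / v ≈ exp (x - y)
  /-exp {u} {v} {x} {y} u≈ v≈ = begin-equality
    u / v                  ≈⟨ *-cong u≈ (⁻¹-unique (<-respʳ-≈ (sym v≈) (0<exp y))
                                (trans (*-congʳ v≈) (exp-inverse (-‿inverseʳ y)))) ⟩
    exp x * exp (- y)      ≈⟨ exp-+ _ _ ⟨
    exp (x - y)            ∎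

  module _ {p r δ : Carrier} (0<p : 0# < p) (0<δ : 0# < δ) (r≈ : r ≈ (1# + δ) * p) where

    0<1+δ : 0# < 1# + δ
    0<1+δ = +-pos-nonneg 0<1 (<⇒≤ 0<δ)

    log-r : log r ≈ log (1# + δ) + log p
    log-r = trans (log-cong (*-pos 0<1+δ 0<p) r≈) (log-* 0<1+δ 0<p)

    -- The logarithm of the bound per trial; the two closed forms and the tilted tail bound are all
    -- compared with exp (exponent · n).
    exponent : Carrier
    exponent = r - p - log (1# + δ) * r

    -- Splitting log r into log (1 + δ) + log p lets the log p from r^r cancel the one from p^r.
    first-form : ∀ n → ((exp r * p ^ᵣ r) / (exp p * r ^ᵣ r)) ^ n ≈ exp (exponent * fromℕ n)
    first-form n = begin-equality
      ((exp r * p ^ᵣ r) / (exp p * r ^ᵣ r)) ^ n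
        ≈⟨ ^-congˡ n (/-exp (sym (exp-+ _ _)) (sym (exp-+ _ _))) ⟩
      exp (r + r * log p - (p + r * log r)) ^ n
        ≈⟨ exp-*-fromℕ _ n ⟨
      exp ((r + r * log p - (p + r * log r)) * fromℕ n)
        ≈⟨ exp-cong (*-congʳ (+-congˡ (-‿cong (+-congˡ (*-congˡ log-r))))) ⟩
      exp ((r + r * log p - (p + r * (log (1# + δ) + log p))) * fromℕ n)
        ≈⟨ exp-cong (*-congʳ (solve 4 (λ r p a b →
             r :+ r :* b :- (p :+ r :* (a :+ b)) := r :- p :- a :* r)
             refl r p (log (1# + δ)) (log p))) ⟩
      exp (exponent * fromℕ n)  ∎

    -- The factor p in the exponent turns δ into r - p and 1 + δ into r.
    second-form : ∀ n → (exp δ / (1# + δ) ^ᵣ (1# + δ)) ^ᵣ (p * fromℕ n) ≈ exp (exponent * fromℕ n)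
    second-form n = exp-cong (begin-equality
      p * fromℕ n * log (exp δ / (1# + δ) ^ᵣ (1# + δ))
        ≈⟨ *-congˡ (log-unique (sym (/-exp refl refl))) ⟩
      p * fromℕ n * (δ - (1# + δ) * log (1# + δ))
        ≈⟨ solve 4 (λ p n δ a → p :* n :* (δ :- (con (+ 1) :+ δ) :* a) :=
             ((con (+ 1) :+ δ) :* p :- p :- a :* ((con (+ 1) :+ δ) :* p)) :* n)
             refl p (fromℕ n) δ (log (1# + δ)) ⟩
      ((1# + δ) * p - p - log (1# + δ) * ((1# + δ) * p)) * fromℕ n
        ≈⟨ *-congʳ (+-cong (+-congʳ r≈) (-‿cong (*-congˡ r≈))) ⟨
      exponent * fromℕ n  ∎)

    tilt-≤ : p < 1# → ∀ n →
      exp (- (log (1# + δ) * ((1# + δ) * p * fromℕ n))) * (p * exp (log (1# + δ)) + (1# - p)) ^ n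
        ≤ exp (exponent * fromℕ n)
    tilt-≤ p<1 n = begin
      exp (- (log (1# + δ) * ((1# + δ) * p * fromℕ n))) * (p * exp (log (1# + δ)) + (1# - p)) ^ n
        ≤⟨ *-monoʳ-≤ (<⇒≤ (0<exp _)) (^-mono-≤ 0≤mean mean≤ n) ⟩
      exp (- (log (1# + δ) * ((1# + δ) * p * fromℕ n))) * exp (r - p) ^ n
        ≈⟨ *-cong (exp-cong (-‿cong (*-congˡ (*-congʳ (sym r≈))))) (sym (exp-*-fromℕ (r - p) n)) ⟩
      exp (- (log (1# + δ) * (r * fromℕ n))) * exp ((r - p) * fromℕ n)
        ≈⟨ exp-+ _ _ ⟨
      exp (- (log (1# + δ) * (r * fromℕ n)) + (r - p) * fromℕ n)
        ≈⟨ exp-cong (solve 4 (λ a r p n →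
             :- (a :* (r :* n)) :+ (r :- p) :* n := (r :- p :- a :* r) :* n)
             refl (log (1# + δ)) r p (fromℕ n)) ⟩
      exp (exponent * fromℕ n)  ∎
      where
      0≤mean : 0# ≤ p * exp (log (1# + δ)) + (1# - p)
      0≤mean = +-nonneg (*-nonneg (<⇒≤ 0<p) (<⇒≤ (0<exp _))) (<⇒≤ (<⇒0<- p<1))
      mean≤ : p * exp (log (1# + δ)) + (1# - p) ≤ exp (r - p)
      mean≤ = begin
        p * exp (log (1# + δ)) + (1# - p)    ≈⟨ +-congʳ (*-congˡ (exp-log 0<1+δ)) ⟩
        p * (1# + δ) + (1# - p)              ≈⟨ solve 2 (λ p δ →
            p :* (con (+ 1) :+ δ) :+ (con (+ 1) :- p) :=
            con (+ 1) :+ ((con (+ 1) :+ δ) :* p :- p)) refl p δ ⟩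
        1# + ((1# + δ) * p - p)              ≈⟨ +-congˡ (+-congʳ r≈) ⟨
        1# + (r - p)                         ≤⟨ 1+x≤exp (r - p) ⟩
        exp (r - p)                          ∎

    0≤log[1+δ] : 0# ≤ log (1# + δ)
    0≤log[1+δ] = exp-cancel-≤ (begin
      exp 0#              ≈⟨ exp-0≈1 ⟩
      1#                  ≤⟨ ≤-by δ (<⇒≤ 0<δ) refl ⟩
      1# + δ              ≈⟨ exp-log 0<1+δ ⟨
      exp (log (1# + δ))  ∎)

-- The tail bound and the equality of its two forms

open import Defs

lemma2 : ⦃ ℝ : Reals ⦄ ⦃ 𝒫 : ProbabilitySpace ⦄ →
    (n : ℕ) → 1 ℕ.≤ n →
    (p : Carrier) → 0# < p → p < 1# →
    (X : Fin n → Ω → Carrier) →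
    (∀ i → IsRandomVariable (X i)) →
    Independent X →
    (∀ i → X i ∼b p) →
    let S = λ (ω : Ω) → sum (λ i → X i ω) in
    (r : Carrier) → p < r → r < 1# →
    (∃ λ (δ : Carrier) → 0# < δ × r ≈ (1# + δ) * p) ×
    (∀ (δ : Carrier) → 0# < δ → r ≈ (1# + δ) * p →
    P (λ ω → S ω ≥ r * fromℕ n) ≈ P (λ ω → S ω ≥ (1# + δ) * p * fromℕ n) ×
    P (λ ω → S ω ≥ (1# + δ) * p * fromℕ n)
    ≤ ((exp r * p ^ᵣ r) / (exp p * r ^ᵣ r)) ^ n ×
    ((exp r * p ^ᵣ r) / (exp p * r ^ᵣ r)) ^ n
    ≈ (exp δ / (1# + δ) ^ᵣ (1# + δ)) ^ᵣ (p * fromℕ n))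
lemma2 ⦃ ℝ ⦄ ⦃ 𝒫 ⦄ n _ p 0<p p<1 X X-rv X-indep X∼b r p<r _ =
  ((r - p) / p , *-pos (<⇒0<- p<r) (⁻¹-pos 0<p) , r≈[1+δ]p) ,
  λ δ 0<δ r≈ →
    P-cong (proj₁ (DecEvent-S≥ 0<p p<1 X-rv X-indep X∼b (r * fromℕ n)))
      (≤-respˡ-≈ (*-congʳ r≈) , ≤-respˡ-≈ (*-congʳ (sym r≈))) ,
    -- The proof of 0 ≤ l fixes the implicit tilt at l = log (1 + δ), that is e^l = 1 + δ.
    ≤-trans (tail-≤ 0<p p<1 X-rv X-indep X∼b (0≤log[1+δ] 0<p 0<δ r≈) _)
      (≤-respʳ-≈ (sym (first-form 0<p 0<δ r≈ n)) (tilt-≤ 0<p 0<δ r≈ p<1 n)) ,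
    trans (first-form 0<p 0<δ r≈ n) (sym (second-form 0<p 0<δ r≈ n))
  where
  open OrderedField ℝ
    hiding (Carrier; _≈_; _<_; _≤_; _≥_; _+_; _*_; _-_; _/_; 0#; 1#; _^_; sum; product; sup; fromℕ)
  open ProbabilitySpace 𝒫 using (P-cong)
  open ≤-Reasoning
  open Chernoff
  open BoundIdentities
  r≈[1+δ]p : r ≈ (1# + (r - p) / p) * p
  r≈[1+δ]p = begin-equality
    r                              ≈⟨ solve 2 (λ r p → r := p :+ (r :- p) :* con (+ 1)) refl r p ⟩
    p + (r - p) * 1#               ≈⟨ +-congˡ (*-congˡ (pos⇒x*x⁻¹≈1 0<p)) ⟨
    p + (r - p) * (p * p ⁻¹)       ≈⟨ solve 3 (λ r p i →
        p :+ (r :- p) :* (p :* i) := (con (+ 1) :+ (r :- p) :* i) :* p) refl r p (p ⁻¹) ⟩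
    (1# + (r - p) / p) * p         ∎
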